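{- Every linear order $D$ with distinct endpoints in a Grothendieck topos defines, with $\min$ and $\max$ as lattice operations and the endpoints as $0$ and $1$, a flat distributive lattice. Hence there is a geometric morphism $\widehat{\Delta}\to\widehat{\Box}$, namely the one classifying the flat distributive lattice defined by the generic linear order with distinct endpoints in $\widehat{\Delta}$.
   Context: A linear order with distinct endpoints in a topos is an internal partial order $(D,\le)$ with least element $0$ and greatest element $1$ satisfying, in the internal logic, $x\le y\vee y\le x$ and $0=1\vdash\bot$. The topos $\widehat{\Delta}$ of simplicial sets classifies these, with generic model $\hom_\Delta(-,[1])$. All distributive lattices are bounded (with $0,1$). $DL(n)$ is the free distributive lattice on $n$ generators. For a distributive lattice $D$ and a map $\alpha:n\to DL(m)$ (an $n$-tuple of lattice polynomials in $m$ variables), $d\mapsto\alpha d$ denotes the evaluation map $D^m\to D^n$. For $\alpha:n\to DL(m)$ and $\gamma:m\to DL(k)$, $\alpha\gamma:n\to DL(k)$ is the Kleisli composite (substitution), so that $(\alpha\gamma)d'=\alpha(\gamma d')$. $D$ is flat if for all $n,m$, all $\alpha,\beta:n\to DL(m)$ and all $d\in D^m$ with $\alpha d=\beta d$, there exist $k$, $\gamma:m\to DL(k)$ and $d'\in D^k$ with $\alpha\gamma=\beta\gamma$ and $\gamma d'=d$; in a topos this is interpreted in the internal logic. $\Box$ is the full subcategory of $\mathrm{Cat}$ on the finite powers of the two-element poset, equivalently the opposite of the category of free finitely generated distributive lattices; $\widehat{\Box}$ is the topos of presheaves on $\Box$ (cubical sets). It classifies flat distributive lattices, with generic model $\mathbb{I}(n)=DL(n)$.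 -}

module Defs where

open import Level using (Level; 0ℓ; _⊔_; Lift; lift) renaming (suc to lsuc)
open import Algebra.Core using (Op₂)
open import Algebra.Definitions using (LeftIdentity)
open import Algebra.Lattice.Structures using (IsDistributiveLattice)
open import Data.Empty using () renaming (⊥ to Empty)
open import Data.Fin.Base using (Fin; zero; suc) renaming (_≤_ to _≤ᶠ_)
open import Data.Fin.Properties using (≤-poset; _≤?_; ≤-antisym; ≤-total; ≤-refl; ≤-reflexive; ≤-trans; all?; ¬∀⟶∃¬)
open import Data.Nat.Base using (ℕ; z≤n; s≤s)
open import Data.Product.Base using (Σ; Σ-syntax; ∃; ∃-syntax; _×_; _,_; proj₁; proj₂)
open import Data.Product.Relation.Binary.Pointwise.NonDependent using (×-setoid)
open import Data.Sum.Base as Sum using (_⊎_; inj₁; inj₂)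
open import Data.Unit.Polymorphic.Base using (tt) renaming (⊤ to Unit)
open import Function.Bundles using (Func; _⟨$⟩_; _↔_; Inverse)
import Function.Construct.Composition as Composition
import Function.Construct.Identity as Identity
open import Function.Relation.Binary.Setoid.Equality using (_⇨_)
open import Relation.Binary.Bundles using (Setoid)
open import Relation.Binary.Core using (Rel)
open import Relation.Binary.Definitions using (Minimum; Maximum)
open import Relation.Binary.Morphism.Bundles using (PosetHomomorphism; mkPosetHomo)
import Relation.Binary.Morphism.Construct.Composition as Mono∘
import Relation.Binary.Morphism.Construct.Identity as MonoId
open import Relation.Binary.PropositionalEquality as ≡ using (_≡_)
open import Relation.Nullary using (¬_; contradiction; yes; no)
open import Relation.Binary.Structures using (IsEquivalence; IsPartialOrder)

private
  variable
    o h e o′ h′ e′ o″ h″ e″ : Level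
    ℓ j : Level

record Category (o h e : Level) : Set (lsuc (o ⊔ h ⊔ e)) where
  infix  4 _≈_ _⇒_
  infixr 9 _∘_
  field
    Obj : Set o
    _⇒_ : Obj → Obj → Set h
    _≈_ : ∀ {A B} → Rel (A ⇒ B) e
    id  : ∀ {A} → A ⇒ A
    _∘_ : ∀ {A B C} → B ⇒ C → A ⇒ B → A ⇒ C
    equiv     : ∀ {A B} → IsEquivalence (_≈_ {A} {B})
    assoc     : ∀ {A B C D} (k : C ⇒ D) (g : B ⇒ C) (f : A ⇒ B) →
                (k ∘ g) ∘ f ≈ k ∘ (g ∘ f)
    identityˡ : ∀ {A B} (f : A ⇒ B) → id ∘ f ≈ f
    identityʳ : ∀ {A B} (f : A ⇒ B) → f ∘ id ≈ f
    ∘-resp-≈  : ∀ {A B C} {g g′ : B ⇒ C} {f f′ : A ⇒ B} →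
                g ≈ g′ → f ≈ f′ → g ∘ f ≈ g′ ∘ f′

  module Equiv {A B : Obj} = IsEquivalence (equiv {A} {B})

  homSetoid : Obj → Obj → Setoid h e
  homSetoid A B = record { isEquivalence = equiv {A} {B} }

op : Category o h e → Category o h e
op C = record
  { Obj = C.Obj
  ; _⇒_ = λ A B → B C.⇒ A
  ; _≈_ = C._≈_
  ; id  = C.id
  ; _∘_ = λ g f → f C.∘ g
  ; equiv = C.equiv
  ; assoc = λ k g f → C.Equiv.sym (C.assoc f g k)
  ; identityˡ = C.identityʳ
  ; identityʳ = C.identityˡ
  ; ∘-resp-≈ = λ p q → C.∘-resp-≈ q p
  }
  where module C = Category C

record Iso (C : Category o h e) (A B : Category.Obj C) : Set (h ⊔ e) where
  open Category C
  field
    to   : A ⇒ B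
    from : B ⇒ A
    isoˡ : from ∘ to ≈ id
    isoʳ : to ∘ from ≈ id

record Functor (C : Category o h e) (D : Category o′ h′ e′) :
               Set (o ⊔ h ⊔ e ⊔ o′ ⊔ h′ ⊔ e′) where
  private
    module C = Category C
    module D = Category D
  field
    F₀ : C.Obj → D.Obj
    F₁ : ∀ {A B} → A C.⇒ B → F₀ A D.⇒ F₀ B
    identity     : ∀ {A} → F₁ (C.id {A}) D.≈ D.id
    homomorphism : ∀ {X Y Z} (g : Y C.⇒ Z) (f : X C.⇒ Y) →
                   F₁ (g C.∘ f) D.≈ F₁ g D.∘ F₁ f
    F-resp-≈     : ∀ {A B} {f g : A C.⇒ B} → f C.≈ g → F₁ f D.≈ F₁ g

idF : {C : Category o h e} → Functor C C
idF {C = C} = record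
  { F₀ = λ A → A
  ; F₁ = λ f → f
  ; identity = Equiv.refl
  ; homomorphism = λ _ _ → Equiv.refl
  ; F-resp-≈ = λ p → p
  }
  where open Category C

infixr 9 _∘F_
_∘F_ : {C : Category o h e} {D : Category o′ h′ e′} {E : Category o″ h″ e″} →
       Functor D E → Functor C D → Functor C E
_∘F_ {E = E} G F = record
  { F₀ = λ A → G.F₀ (F.F₀ A)
  ; F₁ = λ f → G.F₁ (F.F₁ f)
  ; identity = E.Equiv.trans (G.F-resp-≈ F.identity) G.identity
  ; homomorphism = λ g f →
      E.Equiv.trans (G.F-resp-≈ (F.homomorphism g f)) (G.homomorphism (F.F₁ g) (F.F₁ f))
  ; F-resp-≈ = λ p → G.F-resp-≈ (F.F-resp-≈ p)
  }
  where
    module E = Category E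
    module F = Functor F
    module G = Functor G

record NaturalTransformation {C : Category o h e} {D : Category o′ h′ e′}
                             (F G : Functor C D) :
                             Set (o ⊔ h ⊔ h′ ⊔ e′) where
  private
    module C = Category C
    module F = Functor F
    module G = Functor G
  open Category D
  field
    η       : ∀ X → F.F₀ X ⇒ G.F₀ X
    commute : ∀ {X Y} (f : X C.⇒ Y) → η Y ∘ F.F₁ f ≈ G.F₁ f ∘ η X

module _ {C : Category o h e} {D : Category o′ h′ e′} where
  private module D = Category D
  open D.Equiv

  idN : {F : Functor C D} → NaturalTransformation F F
  idN = record
    { η = λ _ → D.id
    ; commute = λ _ → trans (D.identityˡ _) (sym (D.identityʳ _))
    }

  infixr 9 _∘N_
  _∘N_ : {F G H : Functor C D} →
         NaturalTransformation G H → NaturalTransformation F G →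
         NaturalTransformation F H
  β ∘N α = record
    { η = λ X → β.η X D.∘ α.η X
    ; commute = λ f →
        trans (D.assoc _ _ _) (trans (D.∘-resp-≈ refl (α.commute f))
        (trans (sym (D.assoc _ _ _)) (trans (D.∘-resp-≈ (β.commute f) refl)
        (D.assoc _ _ _))))
    }
    where
      module α = NaturalTransformation α
      module β = NaturalTransformation β

Functors : Category o h e → Category o′ h′ e′ →
           Category (o ⊔ h ⊔ e ⊔ o′ ⊔ h′ ⊔ e′) (o ⊔ h ⊔ h′ ⊔ e′) (o ⊔ e′)
Functors C D = record
  { Obj = Functor C D
  ; _⇒_ = NaturalTransformation
  ; _≈_ = λ α β → ∀ X → η α X D.≈ η β X
  ; id  = idN
  ; _∘_ = _∘N_
  ; equiv = record
    { refl  = λ _ → D.Equiv.refl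
    ; sym   = λ p X → D.Equiv.sym (p X)
    ; trans = λ p q X → D.Equiv.trans (p X) (q X)
    }
  ; assoc     = λ _ _ _ _ → D.assoc _ _ _
  ; identityˡ = λ _ _ → D.identityˡ _
  ; identityʳ = λ _ _ → D.identityʳ _
  ; ∘-resp-≈  = λ p q X → D.∘-resp-≈ (p X) (q X)
  }
  where
    module D = Category D
    open NaturalTransformation

module _ {J : Category o′ h′ e′} {C : Category o h e} where
  open Category C
  private module J = Category J

  record Cone (F : Functor J C) : Set (o ⊔ h ⊔ e ⊔ o′ ⊔ h′) where
    private module F = Functor F
    field
      apex    : Obj
      π       : ∀ X → apex ⇒ F.F₀ X
      commute : ∀ {X Y} (f : X J.⇒ Y) → F.F₁ f ∘ π X ≈ π Y

  IsLimit : {F : Functor J C} → Cone F → Set (o ⊔ h ⊔ e ⊔ o′ ⊔ h′)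
  IsLimit {F} L = (K : Cone F) →
    Σ[ u ∈ apex K ⇒ apex L ]
      (∀ X → π L X ∘ u ≈ π K X) ×
      (∀ v → (∀ X → π L X ∘ v ≈ π K X) → v ≈ u)
    where open Cone

mapCone : {J : Category o″ h″ e″} {C : Category o h e} {D : Category o′ h′ e′}
          (G : Functor C D) {F : Functor J C} → Cone F → Cone (G ∘F F)
mapCone {D = D} G L = record
  { apex = F₀ L.apex
  ; π = λ X → F₁ (L.π X)
  ; commute = λ f → Equiv.trans (Equiv.sym (homomorphism _ _)) (F-resp-≈ (L.commute f))
  }
  where
    open Category D
    open Functor G
    module L = Cone L

IsFinite : Category o h e → Set (o ⊔ h ⊔ e)
IsFinite C =
  (∃[ n ] (Fin n ↔ Category.Obj C)) ×
  (∀ A B → ∃[ n ] Inverse (≡.setoid (Fin n)) (Category.homSetoid C A B))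

PreservesFiniteLimits : {C : Category o h e} {D : Category o′ h′ e′} →
                        Functor C D → Set (lsuc 0ℓ ⊔ o ⊔ h ⊔ e ⊔ o′ ⊔ h′ ⊔ e′)
PreservesFiniteLimits {C = C} G =
  (J : Category 0ℓ 0ℓ 0ℓ) → IsFinite J →
  (F : Functor J C) (L : Cone F) → IsLimit L → IsLimit (mapCone G L)

record _⊣_ {C : Category o h e} {D : Category o′ h′ e′}
           (L : Functor C D) (R : Functor D C) :
           Set (o ⊔ h ⊔ e ⊔ o′ ⊔ h′ ⊔ e′) where
  private
    module C = Category C
    module D = Category D
    module L = Functor L
    module R = Functor R
  field
    unit   : NaturalTransformation idF (R ∘F L)
    counit : NaturalTransformation (L ∘F R) idF
  private
    module unit   = NaturalTransformation unit
    module counit = NaturalTransformation counit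
  field
    zig : ∀ A → counit.η (L.F₀ A) D.∘ L.F₁ (unit.η A) D.≈ D.id
    zag : ∀ B → R.F₁ (counit.η B) C.∘ unit.η (R.F₀ B) C.≈ C.id

record GeometricMorphism (E : Category o h e) (F : Category o′ h′ e′) :
                         Set (lsuc 0ℓ ⊔ o ⊔ h ⊔ e ⊔ o′ ⊔ h′ ⊔ e′) where
  field
    inverseImage : Functor F E
    directImage  : Functor E F
    adjunction   : inverseImage ⊣ directImage
    lex          : PreservesFiniteLimits inverseImage

Setoids : ∀ ℓ → Category (lsuc ℓ) ℓ ℓ
Setoids ℓ = record
  { Obj = Setoid ℓ ℓ
  ; _⇒_ = Func
  ; _≈_ = λ {A} {B} → Setoid._≈_ (A ⇨ B)
  ; id  = λ {A} → Identity.function A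
  ; _∘_ = λ g f → Composition.function f g
  ; equiv = λ {A} {B} → Setoid.isEquivalence (A ⇨ B)
  ; assoc     = λ {_} {_} {_} {D} _ _ _ _ → Setoid.refl D
  ; identityˡ = λ {_} {B} _ _ → Setoid.refl B
  ; identityʳ = λ {_} {B} _ _ → Setoid.refl B
  ; ∘-resp-≈  = λ {_} {_} {C} {g} {_} {_} {f′} p q x →
      Setoid.trans C (Func.cong g (q x)) (p (f′ ⟨$⟩ x))
  }

Presheaf : Category ℓ ℓ ℓ → Set (lsuc ℓ)
Presheaf {ℓ} C = Functor (op C) (Setoids ℓ)

Presheaves : Category ℓ ℓ ℓ → Category (lsuc ℓ) ℓ ℓ
Presheaves {ℓ} C = Functors (op C) (Setoids ℓ)

module _ {C : Category ℓ ℓ ℓ} where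
  open Category C using (_⇒_)

  module Sections (P : Presheaf C) where
    open Functor P

    Γ : Category.Obj C → Set ℓ
    Γ U = Setoid.Carrier (F₀ U)

    module _ {U : Category.Obj C} where
      open Setoid (F₀ U) public using (_≈_; isEquivalence)

    infixl 10 _∣_
    _∣_ : ∀ {U V} → Γ U → V ⇒ U → Γ V
    x ∣ f = F₁ f ⟨$⟩ x

  infixr 7 _×ᵖ_
  _×ᵖ_ : Presheaf C → Presheaf C → Presheaf C
  P ×ᵖ Q = record
    { F₀ = λ U → ×-setoid (P.F₀ U) (Q.F₀ U)
    ; F₁ = λ f → record
      { to   = λ (x , y) → P.F₁ f ⟨$⟩ x , Q.F₁ f ⟨$⟩ y
      ; cong = λ (p , q) → Func.cong (P.F₁ f) p , Func.cong (Q.F₁ f) q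
      }
    ; identity     = λ (x , y) → P.identity x , Q.identity y
    ; homomorphism = λ g f (x , y) → P.homomorphism g f x , Q.homomorphism g f y
    ; F-resp-≈     = λ p (x , y) → P.F-resp-≈ p x , Q.F-resp-≈ p y
    }
    where
      module P = Functor P
      module Q = Functor Q

  𝟙ᵖ : Presheaf C
  𝟙ᵖ = record
    { F₀ = λ _ → record
      { Carrier = Unit
      ; _≈_ = λ _ _ → Unit
      ; isEquivalence = _
      }
    ; F₁ = λ _ → record { to = λ x → x ; cong = λ p → p }
    ; identity = _
    ; homomorphism = _
    ; F-resp-≈ = _
    }

  module _ {P Q : Presheaf C} where
    private
      module P = Functor P
      module Q = Functor Q

    projˡ : NaturalTransformation (P ×ᵖ Q) P
    projˡ = record
      { η = λ _ → record { to = proj₁ ; cong = proj₁ }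
      ; commute = λ {_} {U} _ _ → Setoid.refl (P.F₀ U)
      }

    projʳ : NaturalTransformation (P ×ᵖ Q) Q
    projʳ = record
      { η = λ _ → record { to = proj₂ ; cong = proj₂ }
      ; commute = λ {_} {U} _ _ → Setoid.refl (Q.F₀ U)
      }

    ⟨_,_⟩ : {R : Presheaf C} → NaturalTransformation R P →
            NaturalTransformation R Q → NaturalTransformation R (P ×ᵖ Q)
    ⟨ α , β ⟩ = record
      { η = λ U → record
        { to   = λ x → η α U ⟨$⟩ x , η β U ⟨$⟩ x
        ; cong = λ p → Func.cong (η α U) p , Func.cong (η β U) p
        }
      ; commute = λ f x → commute α f x , commute β f x
      }
      where open NaturalTransformation

  ! : {P : Presheaf C} → NaturalTransformation P 𝟙ᵖ
  ! = record { η = λ _ → record { to = λ _ → tt ; cong = λ _ → tt } ; commute = _ }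

  よ : Category.Obj C → Presheaf C
  よ A = record
    { F₀ = λ U → homSetoid U A
    ; F₁ = λ f → record { to = _∘ f ; cong = λ p → ∘-resp-≈ p Equiv.refl }
    ; identity     = identityʳ
    ; homomorphism = λ g f k → Equiv.sym (assoc k f g)
    ; F-resp-≈     = λ p _ → ∘-resp-≈ Equiv.refl p
    }
    where open Category C

record IsBoundedDistributiveLattice {a ℓ} {A : Set a} (_≈_ : Rel A ℓ)
                                    (_∨_ _∧_ : Op₂ A) (⊤ ⊥ : A) :
                                    Set (a ⊔ ℓ) where
  field
    isDistributiveLattice : IsDistributiveLattice _≈_ _∨_ _∧_
    ∧-identityˡ           : LeftIdentity _≈_ ⊤ _∧_
    ∨-identityˡ           : LeftIdentity _≈_ ⊥ _∨_

  open IsDistributiveLattice isDistributiveLattice public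

record BoundedDistributiveLattice c ℓ : Set (lsuc (c ⊔ ℓ)) where
  infix  4 _≈_
  infixr 6 _∨_
  infixr 7 _∧_
  field
    Carrier : Set c
    _≈_     : Rel Carrier ℓ
    _∨_ _∧_ : Op₂ Carrier
    ⊤ ⊥     : Carrier
    isBoundedDistributiveLattice : IsBoundedDistributiveLattice _≈_ _∨_ _∧_ ⊤ ⊥

  open IsBoundedDistributiveLattice isBoundedDistributiveLattice public

  setoid : Setoid c ℓ
  setoid = record { isEquivalence = isEquivalence }

data Poly (n : ℕ) : Set where
  var     : Fin n → Poly n
  _∨_ _∧_ : Poly n → Poly n → Poly n
  ⊤ ⊥     : Poly n

infixr 6 _∨_
infixr 7 _∧_

-- Derivable equality in the equational theory of bounded distributive
-- lattices.

infix 4 _≃_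
data _≃_ {n : ℕ} : Rel (Poly n) 0ℓ where
  ≃-refl  : ∀ {s} → s ≃ s
  ≃-sym   : ∀ {s t} → s ≃ t → t ≃ s
  ≃-trans : ∀ {s t u} → s ≃ t → t ≃ u → s ≃ u
  ∨-cong  : ∀ {s s′ t t′} → s ≃ s′ → t ≃ t′ → s ∨ t ≃ s′ ∨ t′
  ∧-cong  : ∀ {s s′ t t′} → s ≃ s′ → t ≃ t′ → s ∧ t ≃ s′ ∧ t′
  ∨-comm  : ∀ s t → s ∨ t ≃ t ∨ s
  ∧-comm  : ∀ s t → s ∧ t ≃ t ∧ s
  ∨-assoc : ∀ s t u → (s ∨ t) ∨ u ≃ s ∨ (t ∨ u)
  ∧-assoc : ∀ s t u → (s ∧ t) ∧ u ≃ s ∧ (t ∧ u)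
  ∨-absorbs-∧  : ∀ s t → s ∨ (s ∧ t) ≃ s
  ∧-absorbs-∨  : ∀ s t → s ∧ (s ∨ t) ≃ s
  ∨-distribˡ-∧ : ∀ s t u → s ∨ (t ∧ u) ≃ (s ∨ t) ∧ (s ∨ u)
  ∧-distribˡ-∨ : ∀ s t u → s ∧ (t ∨ u) ≃ (s ∧ t) ∨ (s ∧ u)
  ∧-identityˡ  : ∀ s → ⊤ ∧ s ≃ s
  ∨-identityˡ  : ∀ s → ⊥ ∨ s ≃ s

DL : ℕ → BoundedDistributiveLattice 0ℓ 0ℓ
DL n = record
  { Carrier = Poly n
  ; _≈_ = _≃_
  ; _∨_ = _∨_
  ; _∧_ = _∧_
  ; ⊤ = ⊤
  ; ⊥ = ⊥
  ; isBoundedDistributiveLattice = record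
    { isDistributiveLattice = record
      { isLattice = record
        { isEquivalence = record { refl = ≃-refl ; sym = ≃-sym ; trans = ≃-trans }
        ; ∨-comm  = ∨-comm
        ; ∨-assoc = ∨-assoc
        ; ∨-cong  = ∨-cong
        ; ∧-comm  = ∧-comm
        ; ∧-assoc = ∧-assoc
        ; ∧-cong  = ∧-cong
        ; absorptive = ∨-absorbs-∧ , ∧-absorbs-∨
        }
      ; ∨-distrib-∧ = ∨-distribˡ-∧ , λ s t u →
          ≃-trans (∨-comm (t ∧ u) s) (≃-trans (∨-distribˡ-∧ s t u)
          (∧-cong (∨-comm s t) (∨-comm s u)))
      ; ∧-distrib-∨ = ∧-distribˡ-∨ , λ s t u →
          ≃-trans (∧-comm (t ∨ u) s) (≃-trans (∧-distribˡ-∨ s t u)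
          (∨-cong (∧-comm s t) (∧-comm s u)))
      }
    ; ∧-identityˡ = ∧-identityˡ
    ; ∨-identityˡ = ∨-identityˡ
    }
  }

module Evaluation {c ℓ} (L : BoundedDistributiveLattice c ℓ) where
  private module L = BoundedDistributiveLattice L

  ⟦_⟧ : ∀ {m} → Poly m → (Fin m → L.Carrier) → L.Carrier
  ⟦ var i ⟧ d = d i
  ⟦ s ∨ t ⟧ d = ⟦ s ⟧ d L.∨ ⟦ t ⟧ d
  ⟦ s ∧ t ⟧ d = ⟦ s ⟧ d L.∧ ⟦ t ⟧ d
  ⟦ ⊤ ⟧     d = L.⊤
  ⟦ ⊥ ⟧     d = L.⊥

  infixr 8 _◃_
  _◃_ : ∀ {n m} → (Fin n → Poly m) → (Fin m → L.Carrier) → (Fin n → L.Carrier)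
  (α ◃ d) i = ⟦ α i ⟧ d

  infix 4 _≋_
  _≋_ : ∀ {n} → Rel (Fin n → L.Carrier) ℓ
  d ≋ d′ = ∀ i → d i L.≈ d′ i

  ⟦⟧-congʳ : ∀ {m} (t : Poly m) {d d′ : Fin m → L.Carrier} →
             d ≋ d′ → ⟦ t ⟧ d L.≈ ⟦ t ⟧ d′
  ⟦⟧-congʳ (var i) p = p i
  ⟦⟧-congʳ (s ∨ t) p = L.∨-cong (⟦⟧-congʳ s p) (⟦⟧-congʳ t p)
  ⟦⟧-congʳ (s ∧ t) p = L.∧-cong (⟦⟧-congʳ s p) (⟦⟧-congʳ t p)
  ⟦⟧-congʳ ⊤       p = L.refl
  ⟦⟧-congʳ ⊥       p = L.refl

  ⟦⟧-congˡ : ∀ {m} {s t : Poly m} → s ≃ t → ∀ d → ⟦ s ⟧ d L.≈ ⟦ t ⟧ d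
  ⟦⟧-congˡ ≃-refl d = L.refl
  ⟦⟧-congˡ (≃-sym p) d = L.sym (⟦⟧-congˡ p d)
  ⟦⟧-congˡ (≃-trans p q) d = L.trans (⟦⟧-congˡ p d) (⟦⟧-congˡ q d)
  ⟦⟧-congˡ (∨-cong p q) d = L.∨-cong (⟦⟧-congˡ p d) (⟦⟧-congˡ q d)
  ⟦⟧-congˡ (∧-cong p q) d = L.∧-cong (⟦⟧-congˡ p d) (⟦⟧-congˡ q d)
  ⟦⟧-congˡ (∨-comm _ _) d = L.∨-comm _ _
  ⟦⟧-congˡ (∧-comm _ _) d = L.∧-comm _ _
  ⟦⟧-congˡ (∨-assoc _ _ _) d = L.∨-assoc _ _ _
  ⟦⟧-congˡ (∧-assoc _ _ _) d = L.∧-assoc _ _ _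
  ⟦⟧-congˡ (∨-absorbs-∧ _ _) d = L.∨-absorbs-∧ _ _
  ⟦⟧-congˡ (∧-absorbs-∨ _ _) d = L.∧-absorbs-∨ _ _
  ⟦⟧-congˡ (∨-distribˡ-∧ _ _ _) d = L.∨-distribˡ-∧ _ _ _
  ⟦⟧-congˡ (∧-distribˡ-∨ _ _ _) d = L.∧-distribˡ-∨ _ _ _
  ⟦⟧-congˡ (∧-identityˡ _) d = L.∧-identityˡ _
  ⟦⟧-congˡ (∨-identityˡ _) d = L.∨-identityˡ _

-- α ⊙ γ is the Kleisli composite αγ.

module _ {k : ℕ} where
  open Evaluation (DL k) public
    using () renaming (⟦_⟧ to substitute; _◃_ to _⊙_; _≋_ to _≃*_)

substitute-assoc : ∀ {m k l} (t : Poly m) (γ : Fin m → Poly k) (δ : Fin k → Poly l) →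
                   substitute (substitute t γ) δ ≡ substitute t (γ ⊙ δ)
substitute-assoc (var i) γ δ = ≡.refl
substitute-assoc (s ∨ t) γ δ = ≡.cong₂ _∨_ (substitute-assoc s γ δ) (substitute-assoc t γ δ)
substitute-assoc (s ∧ t) γ δ = ≡.cong₂ _∧_ (substitute-assoc s γ δ) (substitute-assoc t γ δ)
substitute-assoc ⊤       γ δ = ≡.refl
substitute-assoc ⊥       γ δ = ≡.refl

substitute-var : ∀ {m} (t : Poly m) → substitute t var ≡ t
substitute-var (var i) = ≡.refl
substitute-var (s ∨ t) = ≡.cong₂ _∨_ (substitute-var s) (substitute-var t)
substitute-var (s ∧ t) = ≡.cong₂ _∧_ (substitute-var s) (substitute-var t)
substitute-var ⊤       = ≡.refl
substitute-var ⊥       = ≡.refl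

≡⇒≃ : ∀ {n} {s t : Poly n} → s ≡ t → s ≃ t
≡⇒≃ ≡.refl = ≃-refl

-- A (bounded distributive) lattice object in a presheaf or sheaf topos:
-- the axioms are equations, so they hold internally iff they hold for
-- all sections over every object.

record LatticeObject {C : Category ℓ ℓ ℓ} (P : Presheaf C) : Set ℓ where
  open Sections P
  field
    meet join : NaturalTransformation (P ×ᵖ P) P
    top bot   : NaturalTransformation 𝟙ᵖ P

  infixr 6 _⋎_
  infixr 7 _⋏_
  _⋎_ : ∀ {U} → Op₂ (Γ U)
  x ⋎ y = NaturalTransformation.η join _ ⟨$⟩ (x , y)

  _⋏_ : ∀ {U} → Op₂ (Γ U)
  x ⋏ y = NaturalTransformation.η meet _ ⟨$⟩ (x , y)

  1# : ∀ {U} → Γ U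
  1# = NaturalTransformation.η top _ ⟨$⟩ tt

  0# : ∀ {U} → Γ U
  0# = NaturalTransformation.η bot _ ⟨$⟩ tt

  field
    isBoundedDistributiveLattice :
      ∀ U → IsBoundedDistributiveLattice (_≈_ {U}) _⋎_ _⋏_ 1# 0#

  sections : Category.Obj C → BoundedDistributiveLattice ℓ ℓ
  sections U = record { isBoundedDistributiveLattice = isBoundedDistributiveLattice U }

record Sieve (C : Category ℓ ℓ ℓ) (U : Category.Obj C) : Set (lsuc ℓ) where
  open Category C
  infix 4 _∋_
  field
    _∋_    : ∀ {V} → V ⇒ U → Set ℓ
    resp   : ∀ {V} {f g : V ⇒ U} → f ≈ g → _∋_ f → _∋_ g
    closed : ∀ {V W} {f : V ⇒ U} → _∋_ f → (g : W ⇒ V) → _∋_ (f ∘ g)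

module _ {C : Category ℓ ℓ ℓ} where
  open Category C using (_⇒_; _∘_; module Equiv; ∘-resp-≈; assoc)
  open Sieve

  pullback : ∀ {U V} → V ⇒ U → Sieve C U → Sieve C V
  pullback f S = record
    { _∋_    = λ g → S ∋ f ∘ g
    ; resp   = λ p → resp S (∘-resp-≈ Equiv.refl p)
    ; closed = λ {_} {_} {g} p k → resp S (assoc f g k) (closed S p k)
    }

-- A small site.  A sieve is maximal iff it contains the identity;
-- requiring all of these to cover also makes covering invariant under
-- extensional equality of sieves.

record Site (ℓ j : Level) : Set (lsuc (ℓ ⊔ j)) where
  open Sieve
  field
    category : Category ℓ ℓ ℓ
  open Category category using (_⇒_; id)
  field
    Covers     : ∀ {U} → Sieve category U → Set j
    maximal    : ∀ {U} (S : Sieve category U) → S ∋ id → Covers S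
    stable     : ∀ {U V} (f : V ⇒ U) {S : Sieve category U} →
                 Covers S → Covers (pullback f S)
    transitive : ∀ {U} {S R : Sieve category U} → Covers S →
                 (∀ {V} {f : V ⇒ U} → S ∋ f → Covers (pullback f R)) → Covers R

trivialSite : Category ℓ ℓ ℓ → Site ℓ ℓ
trivialSite C = record
  { category   = C
  ; Covers     = λ S → S ∋ id
  ; maximal    = λ _ p → p
  ; stable     = λ f {S} p →
      resp S (Equiv.trans (identityˡ f) (Equiv.sym (identityʳ f))) (closed S p f)
  ; transitive = λ {_} {_} {R} p q → resp R (identityʳ id) (q p)
  }
  where
    open Category C
    open Sieve

module _ (S : Site ℓ j) where
  open Site S
  open Category category using (_⇒_; _∘_) renaming (_≈_ to _≈ᶜ_)
  open Sieve

  record MatchingFamily (P : Presheaf category) {U} (R : Sieve category U) : Set ℓ where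
    open Sections P
    field
      at         : ∀ {V} (f : V ⇒ U) → R ∋ f → Γ V
      at-cong    : ∀ {V} {f g : V ⇒ U} → f ≈ᶜ g → (p : R ∋ f) (q : R ∋ g) →
                   at f p ≈ at g q
      compatible : ∀ {V W} (f : V ⇒ U) (p : R ∋ f) (g : W ⇒ V) →
                   at (f ∘ g) (closed R p g) ≈ at f p ∣ g

  record IsSheaf (P : Presheaf category) : Set (lsuc ℓ ⊔ j) where
    open Sections P
    open MatchingFamily
    field
      glue      : ∀ {U} {R : Sieve category U} → Covers R → (m : MatchingFamily P R) →
                  Σ[ x ∈ Γ U ] (∀ {V} (f : V ⇒ U) (p : R ∋ f) → x ∣ f ≈ at m f p)
      separated : ∀ {U} {R : Sieve category U} → Covers R → (x y : Γ U) →
                  (∀ {V} (f : V ⇒ U) → R ∋ f → x ∣ f ≈ y ∣ f) → x ≈ y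

  -- The sheaf semantics of ∃, ∨ and ⊥: truth on the members of a
  -- covering sieve.

  Locally : ∀ {p} (U : Category.Obj category) → (∀ {V} → V ⇒ U → Set p) → Set (lsuc ℓ ⊔ j ⊔ p)
  Locally U Q = Σ[ R ∈ Sieve category U ] Covers R × (∀ {V} (f : V ⇒ U) → R ∋ f → Q f)

  record LinearOrder : Set (lsuc ℓ ⊔ j) where
    infix 4 _≤_
    field
      D       : Presheaf category
      isSheaf : IsSheaf D
    open Sections D
    field
      _≤_        : ∀ {U} → Rel (Γ U) ℓ
      ≤-restrict : ∀ {U V} {x y : Γ U} (f : V ⇒ U) → x ≤ y → x ∣ f ≤ y ∣ f
      ≤-local    : ∀ {U} {R : Sieve category U} → Covers R → (x y : Γ U) →
                   (∀ {V} (f : V ⇒ U) → R ∋ f → x ∣ f ≤ y ∣ f) → x ≤ y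

      isPartialOrder : ∀ U → IsPartialOrder (_≈_ {U}) _≤_

      zero# one# : NaturalTransformation 𝟙ᵖ D

    0# : ∀ {U} → Γ U
    0# = NaturalTransformation.η zero# _ ⟨$⟩ tt

    1# : ∀ {U} → Γ U
    1# = NaturalTransformation.η one# _ ⟨$⟩ tt

    field
      minimum  : ∀ U → Minimum (_≤_ {U}) 0#
      maximum  : ∀ U → Maximum (_≤_ {U}) 1#
      total    : ∀ {U} (x y : Γ U) →
                 Locally U (λ f → (x ∣ f ≤ y ∣ f) ⊎ (y ∣ f ≤ x ∣ f))
      distinct : ∀ {U} → 0# {U} ≈ 1# → Locally U (λ _ → Empty)

  IsFlat : {P : Presheaf category} → LatticeObject P → Set (lsuc ℓ ⊔ j)
  IsFlat {P} L =
    ∀ {n m} (α β : Fin n → Poly m) (U : Category.Obj category) (d : Fin m → Γ U) →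
    (α ◃ d) ≋ (β ◃ d) →
    Locally U λ {V} f →
      ∃[ k ] Σ[ γ ∈ (Fin m → Poly k) ] Σ[ d′ ∈ (Fin k → Γ V) ]
        (α ⊙ γ ≃* β ⊙ γ) × (γ ◃ d′ ≋ λ i → d i ∣ f)
    where
      open Sections P
      module _ {U : Category.Obj category} where
        open Evaluation (LatticeObject.sections L U) public using (_◃_; _≋_)

-- The lattice operations are pinned down by their values on comparable
-- sections, since sections are locally comparable.

record MinMaxLattice {S : Site ℓ j} (D : LinearOrder S) : Set ℓ where
  private module D = LinearOrder D
  open Sections D.D
  field
    lattice : LatticeObject D.D
  open LatticeObject lattice
  field
    x≤y⇒x⋏y≈x : ∀ {U} {x y : Γ U} → x D.≤ y → x ⋏ y ≈ x
    x≥y⇒x⋏y≈y : ∀ {U} {x y : Γ U} → y D.≤ x → x ⋏ y ≈ y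
    x≤y⇒x⋎y≈y : ∀ {U} {x y : Γ U} → x D.≤ y → x ⋎ y ≈ y
    x≥y⇒x⋎y≈x : ∀ {U} {x y : Γ U} → y D.≤ x → x ⋎ y ≈ x
    0≈0       : ∀ {U} → 0# {U} ≈ D.0#
    1≈1       : ∀ {U} → 1# {U} ≈ D.1#

-- The object n is the ordinal [n] = {0 < … < n}.

Δ : Category 0ℓ 0ℓ 0ℓ
Δ = record
  { Obj = ℕ
  ; _⇒_ = λ m n → PosetHomomorphism (≤-poset (ℕ.suc m)) (≤-poset (ℕ.suc n))
  ; _≈_ = λ f g → ∀ i → f · i ≡ g · i
  ; id  = MonoId.posetHomomorphism _
  ; _∘_ = λ g f → Mono∘.posetHomomorphism f g
  ; equiv = record
    { refl  = λ _ → ≡.refl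
    ; sym   = λ p i → ≡.sym (p i)
    ; trans = λ p q i → ≡.trans (p i) (q i)
    }
  ; assoc     = λ _ _ _ _ → ≡.refl
  ; identityˡ = λ _ _ → ≡.refl
  ; identityʳ = λ _ _ → ≡.refl
  ; ∘-resp-≈  = λ {_} {_} {_} {g} {_} {_} {f′} p q i → ≡.trans (≡.cong (g ·_) (q i)) (p (f′ · i))
  }
  where open PosetHomomorphism renaming (⟦_⟧ to _·_)

open Category Δ using () renaming (_⇒_ to _⇒Δ_)

infixl 10 _·_
_·_ : ∀ {m n} → m ⇒Δ n → Fin (ℕ.suc m) → Fin (ℕ.suc n)
_·_ = PosetHomomorphism.⟦_⟧

infix 4 _≤Δ_
_≤Δ_ : ∀ {n} → Rel (n ⇒Δ 1) 0ℓ
f ≤Δ g = ∀ i → f · i ≤ᶠ g · i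

≤Δ-total : ∀ {n} (f g : n ⇒Δ 1) → f ≤Δ g ⊎ g ≤Δ f
≤Δ-total f g with all? (λ i → f · i ≤? g · i)
... | yes f≤g = inj₁ f≤g
... | no f≰g with ¬∀⟶∃¬ _ _ (λ i → f · i ≤? g · i) f≰g
...   | i , fi≰gi = inj₂ λ k → separate (g · i) (f · i) fi≰gi (g · k) (f · k)
          (Sum.map (mono g) (mono f) (≤-total k i))
  where
    open PosetHomomorphism using (mono)
    separate : (a b : Fin 2) → ¬ b ≤ᶠ a → (a′ b′ : Fin 2) → a′ ≤ᶠ a ⊎ b ≤ᶠ b′ → a′ ≤ᶠ b′
    separate zero       zero       ¬p _          _          _        = contradiction z≤n ¬p
    separate (suc zero) zero       ¬p _          _          _        = contradiction z≤n ¬p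
    separate (suc zero) (suc zero) ¬p _          _          _        = contradiction (s≤s z≤n) ¬p
    separate zero       (suc zero) _  zero       _          _        = z≤n
    separate zero       (suc zero) _  (suc zero) (suc zero) _        = s≤s z≤n
    separate zero       (suc zero) _  (suc zero) zero       (inj₁ ())
    separate zero       (suc zero) _  (suc zero) zero       (inj₂ ())

genericLinearOrder : LinearOrder (trivialSite Δ)
genericLinearOrder = record
  { D = よ 1
  ; isSheaf = record
    { glue      = λ {_} {R} p m → at m id p , λ f q →
        Equiv.sym {x = at m f q} {y = at m id p ∘ f}
          (λ i → ≡.trans (at-cong m (λ _ → ≡.refl) q (Sieve.closed R p f) i)
                         (compatible m id p f i))
    ; separated = λ p _ _ x≈y → x≈y id p
    }
  ; _≤_ = _≤Δ_
  ; ≤-restrict = λ f x≤y i → x≤y (f · i)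
  ; ≤-local = λ p _ _ x≤y → x≤y id p
  ; isPartialOrder = λ _ → record
    { isPreorder = record
      { isEquivalence = Category.equiv Δ
      ; reflexive     = λ x≈y i → ≤-reflexive (x≈y i)
      ; trans         = λ x≤y y≤z i → ≤-trans (x≤y i) (y≤z i)
      }
    ; antisym = λ x≤y y≤x i → ≤-antisym (x≤y i) (y≤x i)
    }
  ; zero# = constant zero
  ; one#  = constant (suc zero)
  ; minimum = λ _ _ _ → z≤n
  ; maximum = λ _ x i → ≤1 (x · i)
  ; total = λ x y → everywhere , _ , λ f _ → ≤Δ-total (x ∘ f) (y ∘ f)
  ; distinct = λ 0≈1 → contradiction (0≈1 zero) λ ()
  }
  where
    open Category Δ using (id; _∘_; module Equiv)
    open MatchingFamily

    constant : Fin 2 → NaturalTransformation 𝟙ᵖ (よ {C = Δ} 1)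
    constant b = record
      { η = λ _ → record { to = λ _ → mkPosetHomo _ _ (λ _ → b) (λ _ → ≤-refl)
                         ; cong = λ _ _ → ≡.refl }
      ; commute = λ _ _ _ → ≡.refl
      }

    ≤1 : (b : Fin 2) → b ≤ᶠ suc (zero {0})
    ≤1 zero       = z≤n
    ≤1 (suc zero) = s≤s z≤n

    everywhere : ∀ {U} → Sieve Δ U
    everywhere = record { _∋_ = λ _ → Unit ; resp = _ ; closed = _ }

-- The opposite of the category of finitely generated free bounded
-- distributive lattices: maps m → n are homomorphisms DL n → DL m, given
-- by their values on the generators.

□ : Category 0ℓ 0ℓ 0ℓ
□ = record
  { Obj = ℕ
  ; _⇒_ = λ m n → Fin n → Poly m
  ; _≈_ = _≃*_
  ; id  = var
  ; _∘_ = _⊙_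
  ; equiv = record
    { refl  = λ _ → ≃-refl
    ; sym   = λ p i → ≃-sym (p i)
    ; trans = λ p q i → ≃-trans (p i) (q i)
    }
  ; assoc     = λ k g f i → ≡⇒≃ (substitute-assoc (k i) g f)
  ; identityˡ = λ _ _ → ≃-refl
  ; identityʳ = λ f i → ≡⇒≃ (substitute-var (f i))
  ; ∘-resp-≈  = λ {m} {_} {_} {g} {g′} {f} {f′} p q i →
      ≃-trans (Evaluation.⟦⟧-congʳ (DL m) (g i) q) (Evaluation.⟦⟧-congˡ (DL m) (p i) f′)
  }

𝕀 : Presheaf □
𝕀 = record
  { F₀ = λ n → BoundedDistributiveLattice.setoid (DL n)
  ; F₁ = λ {_} {m} α → record
    { to   = λ t → substitute t α
    ; cong = λ p → Evaluation.⟦⟧-congˡ (DL m) p α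
    }
  ; identity     = λ t → ≡⇒≃ (substitute-var t)
  ; homomorphism = λ β α t → ≡⇒≃ (≡.sym (substitute-assoc t α β))
  ; F-resp-≈     = λ {_} {m} p t → Evaluation.⟦⟧-congʳ (DL m) t p
  }

𝕀-lattice : LatticeObject 𝕀
𝕀-lattice = record
  { meet = record
    { η = λ _ → record { to = λ (s , t) → s ∧ t ; cong = λ (p , q) → ∧-cong p q }
    ; commute = λ _ _ → ≃-refl
    }
  ; join = record
    { η = λ _ → record { to = λ (s , t) → s ∨ t ; cong = λ (p , q) → ∨-cong p q }
    ; commute = λ _ _ → ≃-refl
    }
  ; top = record
    { η = λ _ → record { to = λ _ → ⊤ ; cong = λ _ → ≃-refl } ; commute = λ _ _ → ≃-refl }
  ; bot = record
    { η = λ _ → record { to = λ _ → ⊥ ; cong = λ _ → ≃-refl } ; commute = λ _ _ → ≃-refl }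
  ; isBoundedDistributiveLattice = λ n →
      BoundedDistributiveLattice.isBoundedDistributiveLattice (DL n)
  }

-- The lattice structure of f* 𝕀 consists of the images under f* of the
-- operations of 𝕀, as f* (𝕀 × 𝕀) is a product of f* 𝕀 with itself via
-- the images of the projections.  The equations below say that an
-- isomorphism f* 𝕀 ≅ P is one of lattice objects.

module _ {C : Category 0ℓ 0ℓ 0ℓ} where
  open Category (Presheaves C) using (_≈_; _∘_)

  record Classifies (f : GeometricMorphism (Presheaves C) (Presheaves □))
                    {P : Presheaf C} (L : LatticeObject P) : Set where
    private
      module 𝕀 = LatticeObject 𝕀-lattice
      module L = LatticeObject L
    open GeometricMorphism f using (inverseImage)
    open Functor inverseImage renaming (F₀ to f*₀; F₁ to f*₁)
    field
      iso : Iso (Presheaves C) (f*₀ 𝕀) P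
    open Iso iso public using () renaming (to to φ)
    field
      preserves-meet : φ ∘ f*₁ 𝕀.meet ≈ L.meet ∘ ⟨ φ ∘ f*₁ projˡ , φ ∘ f*₁ projʳ ⟩
      preserves-join : φ ∘ f*₁ 𝕀.join ≈ L.join ∘ ⟨ φ ∘ f*₁ projˡ , φ ∘ f*₁ projʳ ⟩
      preserves-top  : φ ∘ f*₁ 𝕀.top ≈ L.top ∘ !
      preserves-bot  : φ ∘ f*₁ 𝕀.bot ≈ L.bot ∘ !

  -- Uniqueness up to an isomorphism of inverse image functors that is
  -- compatible with the identifications with L.

  EssentiallyUnique : ∀ {f} {P : Presheaf C} {L : LatticeObject P} →
                      Classifies f L → Set₁
  EssentiallyUnique {f} {L = L} c =
    ∀ g (c′ : Classifies g L) →
    Σ[ θ ∈ Iso (Functors (Presheaves □) (Presheaves C)) (inverseImage f) (inverseImage g) ]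
      Classifies.φ c′ ∘ NaturalTransformation.η (Iso.to θ) 𝕀 ≈ Classifies.φ c
    where open GeometricMorphism

-- A finite chain d in a distributive lattice lifts to a chain γ of polynomials
-- with γd = d.  Substituting γ turns every polynomial into a generator γ_i, ⊤
-- or ⊥, so an equation αd = βd either holds formally after substituting γ, or
-- identifies two different members of {d_1, …, d_m, 1, 0}, which gives 0 = 1 or
-- eliminates a variable.  In a linear order all components of d are comparable
-- on a cover, hence flatness.
--
-- The sections D[n] of the generic linear order over [n] are a retract of
-- DL(n), so Δ embeds into the idempotent completion of □.  Accordingly (f*X)[n]
-- is the set of elements of X(n) fixed by the corresponding idempotent, and
-- (f₊Y)(m) = Nat(Dᵐ, Y).  If g also classifies D, then g*(よ m) ≅ (g*𝕀)ᵐ ≅ Dᵐ,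
-- since g* preserves the product よ m ≅ 𝕀ᵐ; transposing along g* ⊣ g₊ yields
-- g* ≅ f*.

module Submission where

open import Defs
open import Algebra.Lattice.Bundles using (Lattice)
import Algebra.Lattice.Properties.Lattice as LatticeProperties
open import Data.Bool.Base using (Bool; true; false)
import Data.Bool.Properties as Bool
open import Data.Empty using (⊥-elim) renaming (⊥ to Empty)
open import Data.Fin.Base using (Fin; zero; suc; punchOut) renaming (_≤_ to _≤ᶠ_)
open import Data.Fin.Properties using (all?; ¬∀⟶∃¬; punchIn-punchOut)
  renaming (_≟_ to _≟ᶠ_; ≤-reflexive to ≤ᶠ-reflexive; ≤-trans to ≤ᶠ-trans)
open import Data.Nat.Base using (ℕ; zero; suc; z≤n; s≤s)
open import Data.Product.Base using (Σ-syntax; ∃-syntax; _×_; _,_; proj₁; proj₂)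
open import Data.Sum.Base as Sum using (_⊎_; inj₁; inj₂)
open import Data.Sum.Properties using (≡-dec)
open import Data.Unit.Polymorphic.Base using (tt) renaming (⊤ to Unit)
open import Data.Vec.Functional using (foldr; insertAt; removeAt)
open import Data.Vec.Functional.Properties using (insertAt-lookup; insertAt-punchIn)
open import Function.Base using (_∘′_; flip)
open import Function.Bundles using (Func; _⟨$⟩_; Inverse)
import Function.Construct.Identity as Identity
open import Level using (Level; Lift; 0ℓ) renaming (_⊔_ to _⊔ˡ_)
open import Relation.Binary.Bundles using (Setoid)
import Relation.Binary.Construct.Flip.EqAndOrd as Flip
import Relation.Binary.Construct.On as On
open import Relation.Binary.Definitions using (DecidableEquality; Minimum; Maximum)
import Relation.Binary.Lattice as OrderTheoretic
import Relation.Binary.Lattice.Properties.DistributiveLattice as DistributiveProperties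
import Relation.Binary.Lattice.Properties.JoinSemilattice as JoinProperties
import Relation.Binary.Lattice.Properties.Lattice as OrderLatticeProperties
import Relation.Binary.Lattice.Properties.MeetSemilattice as MeetProperties
open import Relation.Binary.Morphism.Bundles using (PosetHomomorphism; mkPosetHomo)
open import Relation.Binary.PropositionalEquality as ≡ using (_≡_; _≢_)
import Relation.Binary.Reasoning.Setoid as SetoidReasoning
open import Relation.Binary.Structures using (IsPartialOrder)
open import Relation.Nullary using (Dec; yes; no; contradiction)

open MinMaxLattice using (lattice)

-- Flatness asks for a unifier `γ` of `α` and `β` through which `d` factors. The chain of
-- polynomials lifting `d` can fail to be one, but only if two different literals agree at `d`.
-- Unless both are constants, this coincidence writes one component of `d` in terms of the others,
-- and the search starts afresh with one variable fewer. The alternative 0 = 1 cannot be refuted at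
-- a single stage: the axiom `distinct` only turns it into a cover without members, on which any
-- claim holds vacuously.
--
-- The inverse image of a classifying morphism is a left Kan extension along the Yoneda embedding,
-- and its left exactness is the delicate point. Because each lattice of sections is a retract of a
-- free one, the colimit in question is the splitting of an idempotent. A splitting is also an
-- equalizer, so it commutes with all limits, and left exactness can be checked at each object. The
-- construction is therefore carried out for any lattice object with such sections; the ordinals
-- enter only where the retractions are built.

private
  variable
    a o h e o′ h′ e′ ℓ j : Level

-- Chains in distributive lattices

module LatticeOrder (L : BoundedDistributiveLattice a ℓ) where
  open BoundedDistributiveLattice L using (Carrier; _≈_; refl; sym; trans)
  private module L = BoundedDistributiveLattice L

  private
    algebraicLattice : Lattice a ℓ
    algebraicLattice = record { isLattice = L.isLattice }

    orderTheoreticLattice : OrderTheoretic.Lattice a ℓ ℓ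
    orderTheoreticLattice =
      LatticeProperties.∨-∧-orderTheoreticLattice algebraicLattice

  open OrderTheoretic.Lattice orderTheoreticLattice public
    using (_≤_; x≤x∨y; y≤x∨y; x∧y≤x; x∧y≤y; ∨-least)
    renaming (refl to ≤-refl; trans to ≤-trans; antisym to ≤-antisym)
  open JoinProperties (OrderTheoretic.Lattice.joinSemilattice orderTheoreticLattice) public
    using (x≤y⇒x∨y≈y; ∨-monotonic)
  open MeetProperties (OrderTheoretic.Lattice.meetSemilattice orderTheoreticLattice) public
    using (y≤x⇒x∧y≈y; ∧-monotonic)

  ⊥-minimum : Minimum _≤_ L.⊥
  ⊥-minimum x = trans (sym (L.∧-absorbs-∨ L.⊥ x)) (L.∧-cong refl (L.∨-identityˡ x))

  ⊤-maximum : Maximum _≤_ L.⊤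
  ⊤-maximum x = trans (sym (L.∧-identityˡ x)) (L.∧-comm L.⊤ x)

  Comparable : Carrier → Carrier → Set ℓ
  Comparable x y = x ≤ y ⊎ y ≤ x

  Chain : ∀ {m} → (Fin m → Carrier) → Set ℓ
  Chain d = ∀ i j → Comparable (d i) (d j)

module DLOrder {m : ℕ} = LatticeOrder (DL m)

-- The order unfolds to the equation `s ≃ s ∧ t`, so monotonicity is an instance of evaluation
-- preserving equations.
substitute-≤ : ∀ {m k} (γ : Fin m → Poly k) {s t : Poly m} →
               s DLOrder.≤ t → substitute s γ DLOrder.≤ substitute t γ
substitute-≤ {k = k} γ s≤t = Evaluation.⟦⟧-congˡ (DL k) s≤t γ

-- The possible values of a polynomial at a chain, kept as syntax: equality of literals is
-- decidable, while `_≈_` in the lattice is not assumed to be.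
Literal : ℕ → Set
Literal m = Bool ⊎ Fin m

infix 4 _≟_
_≟_ : ∀ {m} → DecidableEquality (Literal m)
_≟_ = ≡-dec Bool._≟_ _≟ᶠ_

literal : ∀ {m} → Literal m → Poly m
literal (inj₁ false) = ⊥
literal (inj₁ true)  = ⊤
literal (inj₂ i)     = var i

module EvaluationProperties (L : BoundedDistributiveLattice a ℓ) where
  open BoundedDistributiveLattice L using (Carrier; _≈_; refl; sym; trans; reflexive)
  private module L = BoundedDistributiveLattice L
  open Evaluation L public
  open LatticeOrder L public

  ⟦substitute⟧ : ∀ {m k} (t : Poly m) (γ : Fin m → Poly k) (d : Fin k → Carrier) →
                 ⟦ substitute t γ ⟧ d ≡ ⟦ t ⟧ (γ ◃ d)
  ⟦substitute⟧ (var i) γ d = ≡.refl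
  ⟦substitute⟧ (s ∨ t) γ d = ≡.cong₂ L._∨_ (⟦substitute⟧ s γ d) (⟦substitute⟧ t γ d)
  ⟦substitute⟧ (s ∧ t) γ d = ≡.cong₂ L._∧_ (⟦substitute⟧ s γ d) (⟦substitute⟧ t γ d)
  ⟦substitute⟧ ⊤       γ d = ≡.refl
  ⟦substitute⟧ ⊥       γ d = ≡.refl

  ⊙-◃ : ∀ {n m k} (α : Fin n → Poly m) (γ : Fin m → Poly k) {d : Fin k → Carrier}
        {d′ : Fin m → Carrier} → γ ◃ d ≋ d′ → (α ⊙ γ) ◃ d ≋ α ◃ d′
  ⊙-◃ α γ p i = trans (reflexive (⟦substitute⟧ (α i) γ _)) (⟦⟧-congʳ (α i) p)

  literals-comparable : ∀ {m} {d : Fin m → Carrier} → Chain d → (u v : Literal m) →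
                        Comparable (⟦ literal u ⟧ d) (⟦ literal v ⟧ d)
  literals-comparable ch (inj₁ false) v            = inj₁ (⊥-minimum _)
  literals-comparable ch (inj₁ true)  v            = inj₂ (⊤-maximum _)
  literals-comparable ch (inj₂ i)     (inj₁ false) = inj₂ (⊥-minimum _)
  literals-comparable ch (inj₂ i)     (inj₁ true)  = inj₁ (⊤-maximum _)
  literals-comparable ch (inj₂ i)     (inj₂ j)     = ch i j

  module _ {m : ℕ} {d : Fin m → Carrier} (ch : Chain d) where

    -- The join or meet of two comparable elements is one of the two, so a chain together with the
    -- constants is closed under both operations.
    chain-value : ∀ t → ∃[ u ] ⟦ t ⟧ d ≈ ⟦ literal u ⟧ d
    chain-value (var i) = inj₂ i , refl
    chain-value ⊤       = inj₁ true , refl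
    chain-value ⊥       = inj₁ false , refl
    chain-value (s ∨ t) with chain-value s | chain-value t
    ... | u , p | v , q with literals-comparable ch u v
    ...   | inj₁ u≤v = v , trans (L.∨-cong p q) (x≤y⇒x∨y≈y u≤v)
    ...   | inj₂ v≤u = u , trans (L.∨-comm _ _) (trans (L.∨-cong q p) (x≤y⇒x∨y≈y v≤u))
    chain-value (s ∧ t) with chain-value s | chain-value t
    ... | u , p | v , q with literals-comparable ch u v
    ...   | inj₁ u≤v = u , trans (L.∧-comm _ _) (trans (L.∧-cong q p) (y≤x⇒x∧y≈y u≤v))
    ...   | inj₂ v≤u = v , trans (L.∧-cong p q) (y≤x⇒x∧y≈y v≤u)

module Unification (L : BoundedDistributiveLattice a ℓ) where
  open BoundedDistributiveLattice L using (Carrier; _≈_; refl; sym; trans; reflexive)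
  private module L = BoundedDistributiveLattice L
  open EvaluationProperties L

  -- By induction: each polynomial found so far is pushed to its side of the new variable by joining
  -- or meeting with `var zero`. At `d` this changes nothing, because the component in question
  -- already lies on that side of `d zero`.
  lift-chain : ∀ {m} (d : Fin m → Carrier) → Chain d →
               Σ[ γ ∈ (Fin m → Poly m) ] DLOrder.Chain γ × γ ◃ d ≋ d
  lift-chain {zero}  d ch = (λ ()) , (λ ()) , λ ()
  lift-chain {suc m} d ch with lift-chain (d ∘′ suc) (λ i j → ch (suc i) (suc j))
  ... | γ , γ-chain , γ◃d≋d = γ⁺ , γ⁺-chain , γ⁺◃d≋d
    where
    open DLOrder using () renaming (x≤x∨y to s≤s∨t; x∧y≤x to s∧t≤s)

    weaken : Fin m → Poly (suc m)
    weaken i = substitute (γ i) (var ∘′ suc)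

    -- The choices made by ch need not be transitive, but polynomials attached to
    -- the same side of var zero stay comparable, and var zero separates the sides.
    attach : ∀ {A B : Set ℓ} → A ⊎ B → Poly (suc m) → Poly (suc m)
    attach (inj₁ _) t = var zero ∨ t
    attach (inj₂ _) t = var zero ∧ t

    γ⁺ : Fin (suc m) → Poly (suc m)
    γ⁺ zero    = var zero
    γ⁺ (suc i) = attach (ch zero (suc i)) (weaken i)

    head-comparable : ∀ {A B : Set ℓ} (p : A ⊎ B) t →
                      DLOrder.Comparable (var zero) (attach p t)
    head-comparable (inj₁ _) t = inj₁ (s≤s∨t (var zero) t)
    head-comparable (inj₂ _) t = inj₂ (s∧t≤s (var zero) t)

    attach-comparable : ∀ {A B A′ B′ : Set ℓ} (p : A ⊎ B) (q : A′ ⊎ B′) {s t} →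
                        DLOrder.Comparable s t →
                        DLOrder.Comparable (attach p s) (attach q t)
    attach-comparable (inj₁ _) (inj₁ _) (inj₁ s≤t) = inj₁ (DLOrder.∨-monotonic DLOrder.≤-refl s≤t)
    attach-comparable (inj₁ _) (inj₁ _) (inj₂ t≤s) = inj₂ (DLOrder.∨-monotonic DLOrder.≤-refl t≤s)
    attach-comparable (inj₁ _) (inj₂ _) _ = inj₂ (DLOrder.≤-trans (s∧t≤s _ _) (s≤s∨t _ _))
    attach-comparable (inj₂ _) (inj₁ _) _ = inj₁ (DLOrder.≤-trans (s∧t≤s _ _) (s≤s∨t _ _))
    attach-comparable (inj₂ _) (inj₂ _) (inj₁ s≤t) = inj₁ (DLOrder.∧-monotonic DLOrder.≤-refl s≤t)
    attach-comparable (inj₂ _) (inj₂ _) (inj₂ t≤s) = inj₂ (DLOrder.∧-monotonic DLOrder.≤-refl t≤s)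

    weaken-comparable : ∀ i j → DLOrder.Comparable (weaken i) (weaken j)
    weaken-comparable i j with γ-chain i j
    ... | inj₁ p = inj₁ (substitute-≤ (var ∘′ suc) p)
    ... | inj₂ p = inj₂ (substitute-≤ (var ∘′ suc) p)

    γ⁺-chain : DLOrder.Chain γ⁺
    γ⁺-chain zero    zero    = inj₁ DLOrder.≤-refl
    γ⁺-chain zero    (suc j) = head-comparable (ch zero (suc j)) (weaken j)
    γ⁺-chain (suc i) zero    with head-comparable (ch zero (suc i)) (weaken i)
    ... | inj₁ p = inj₂ p
    ... | inj₂ p = inj₁ p
    γ⁺-chain (suc i) (suc j) =
      attach-comparable (ch zero (suc i)) (ch zero (suc j)) (weaken-comparable i j)

    ⟦attach⟧ : ∀ {y} (p : Comparable (d zero) y) {t} → ⟦ t ⟧ d ≈ y → ⟦ attach p t ⟧ d ≈ y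
    ⟦attach⟧ (inj₁ x≤y) t≈y = trans (L.∨-cong refl t≈y) (x≤y⇒x∨y≈y x≤y)
    ⟦attach⟧ (inj₂ y≤x) t≈y = trans (L.∧-cong refl t≈y) (y≤x⇒x∧y≈y y≤x)

    γ⁺◃d≋d : γ⁺ ◃ d ≋ d
    γ⁺◃d≋d zero    = refl
    γ⁺◃d≋d (suc i) = ⟦attach⟧ (ch zero (suc i))
      (trans (⊙-◃ γ (var ∘′ suc) (λ _ → refl) i) (γ◃d≋d i))

  -- The split on `m` exposes the smaller number of variables, which makes the recursion in
  -- `chain-unifiable` structural. With no variables there is nothing to eliminate.
  Eliminable : ∀ m → (Fin m → Carrier) → Set ℓ
  Eliminable zero    d = Lift ℓ Empty
  Eliminable (suc m) d = Σ[ i ∈ Fin (suc m) ] Σ[ δ ∈ (Fin (suc m) → Poly m) ] δ ◃ removeAt d i ≋ d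

  -- A literal other than the variable `i` does not mention `i`, so it can be rewritten over the
  -- remaining components and substituted for that variable.
  eliminate-var : ∀ {m} (d : Fin m → Carrier) i (u : Literal m) → inj₂ i ≢ u →
                  d i ≈ ⟦ literal u ⟧ d → Eliminable m d
  eliminate-var {suc m} d i u i≢u p = i , δ , δ◃d≋d
    where
    rest : (v : Literal (suc m)) → inj₂ i ≢ v →
           Σ[ t ∈ Poly m ] ⟦ t ⟧ (removeAt d i) ≈ ⟦ literal v ⟧ d
    rest (inj₁ false) _   = ⊥ , refl
    rest (inj₁ true)  _   = ⊤ , refl
    rest (inj₂ k)     i≢k =
      var (punchOut (i≢k ∘′ ≡.cong inj₂)) , reflexive (≡.cong d (punchIn-punchOut _))

    t : Poly m
    t = proj₁ (rest u i≢u)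

    δ : Fin (suc m) → Poly m
    δ = insertAt var i t

    ⟦⟧-≡ : ∀ {p q} → p ≡ q → ⟦ p ⟧ (removeAt d i) ≈ ⟦ q ⟧ (removeAt d i)
    ⟦⟧-≡ p≡q = reflexive (≡.cong (λ r → ⟦ r ⟧ (removeAt d i)) p≡q)

    δ◃d≋d : δ ◃ removeAt d i ≋ d
    δ◃d≋d k with i ≟ᶠ k
    ... | yes ≡.refl = trans (⟦⟧-≡ (insertAt-lookup var i t)) (trans (proj₂ (rest u i≢u)) (sym p))
    ... | no i≢k = ≡.subst (λ l → ⟦ δ l ⟧ (removeAt d i) ≈ d l) (punchIn-punchOut i≢k)
                     (⟦⟧-≡ (insertAt-punchIn var i t (punchOut i≢k)))

  eliminate : ∀ {m} (d : Fin m → Carrier) (u v : Literal m) → u ≢ v →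
              ⟦ literal u ⟧ d ≈ ⟦ literal v ⟧ d → L.⊥ ≈ L.⊤ ⊎ Eliminable m d
  eliminate d (inj₁ false) (inj₁ false) u≢v _ = contradiction ≡.refl u≢v
  eliminate d (inj₁ false) (inj₁ true)  _   p = inj₁ p
  eliminate d (inj₁ true)  (inj₁ false) _   p = inj₁ (sym p)
  eliminate d (inj₁ true)  (inj₁ true)  u≢v _ = contradiction ≡.refl u≢v
  eliminate d (inj₂ i)     v            u≢v p = inj₂ (eliminate-var d i v u≢v p)
  eliminate d u            (inj₂ i)     u≢v p = inj₂ (eliminate-var d i u (u≢v ∘′ ≡.sym) (sym p))

  Unifiable : ∀ {n m} (α β : Fin n → Poly m) (d : Fin m → Carrier) → Set (a ⊔ˡ ℓ)
  Unifiable {m = m} α β d =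
    ∃[ k ] Σ[ γ ∈ (Fin m → Poly k) ] Σ[ d′ ∈ (Fin k → Carrier) ]
      (α ⊙ γ ≃* β ⊙ γ) × (γ ◃ d′ ≋ d)

  unify-or-eliminate : ∀ {n m} (α β : Fin n → Poly m) (d : Fin m → Carrier) → Chain d →
                       α ◃ d ≋ β ◃ d → Unifiable α β d ⊎ L.⊥ ≈ L.⊤ ⊎ Eliminable m d
  unify-or-eliminate {m = m} α β d ch αd≋βd with lift-chain d ch
  ... | γ , γ-chain , γ◃d≋d = compare (all? (λ i → value (α i) ≟ value (β i)))
    where
    -- `chain-value` is applied in `DL m` to the chain `γ`, not in `L` to `d`. The resulting
    -- equations hold formally, and evaluating them at `d` gives the values in `L`.
    open EvaluationProperties (DL m) using () renaming (chain-value to polynomial-value)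

    value : Poly m → Literal m
    value t = proj₁ (polynomial-value γ-chain t)

    value-correct : ∀ t → substitute t γ ≃ substitute (literal (value t)) γ
    value-correct t = proj₂ (polynomial-value γ-chain t)

    ⟦substitute-γ⟧ : ∀ t → ⟦ substitute t γ ⟧ d ≈ ⟦ t ⟧ d
    ⟦substitute-γ⟧ t = trans (reflexive (⟦substitute⟧ t γ d)) (⟦⟧-congʳ t γ◃d≋d)

    ⟦value⟧ : ∀ t → ⟦ literal (value t) ⟧ d ≈ ⟦ t ⟧ d
    ⟦value⟧ t = trans (sym (⟦substitute-γ⟧ (literal (value t))))
      (trans (⟦⟧-congˡ (≃-sym (value-correct t)) d) (⟦substitute-γ⟧ t))

    compare : Dec (∀ i → value (α i) ≡ value (β i)) →
              Unifiable α β d ⊎ L.⊥ ≈ L.⊤ ⊎ Eliminable m d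
    compare (yes p) = inj₁ (m , γ , d , αγ≃βγ , γ◃d≋d)
      where
      αγ≃βγ : α ⊙ γ ≃* β ⊙ γ
      αγ≃βγ i = ≃-trans (value-correct (α i))
        (≃-trans (≡⇒≃ (≡.cong (λ u → substitute (literal u) γ) (p i)))
                 (≃-sym (value-correct (β i))))
    compare (no ¬p) with ¬∀⟶∃¬ _ _ (λ i → value (α i) ≟ value (β i)) ¬p
    ... | i , u≢v = inj₂ (eliminate d _ _ u≢v
                      (trans (⟦value⟧ (α i)) (trans (αd≋βd i) (sym (⟦value⟧ (β i))))))

  -- Each elimination passes to `α ⊙ δ` and `β ⊙ δ` over one variable fewer, and a unifier `γ` of
  -- these yields the unifier `δ ⊙ γ` of `α` and `β`.
  chain-unifiable : ∀ {n} m (α β : Fin n → Poly m) (d : Fin m → Carrier) → Chain d →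
                    α ◃ d ≋ β ◃ d → L.⊥ ≈ L.⊤ ⊎ Unifiable α β d
  chain-unifiable m α β d ch αd≋βd with unify-or-eliminate α β d ch αd≋βd
  ... | inj₁ u        = inj₂ u
  ... | inj₂ (inj₁ p) = inj₁ p
  chain-unifiable (suc m) α β d ch αd≋βd | inj₂ (inj₂ (i , δ , δ◃d≋d))
    with chain-unifiable m (α ⊙ δ) (β ⊙ δ) (removeAt d i) (λ k l → ch _ _)
           (λ k → trans (⊙-◃ α δ δ◃d≋d k) (trans (αd≋βd k) (sym (⊙-◃ β δ δ◃d≋d k))))
  ... | inj₁ p = inj₁ p
  ... | inj₂ (k , γ , d′ , αδγ≃βδγ , γ◃d′≋d) = inj₂
    (k , δ ⊙ γ , d′
    , (λ l → ≃-trans (≡⇒≃ (≡.sym (substitute-assoc (α l) δ γ)))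
               (≃-trans (αδγ≃βδγ l) (≡⇒≃ (substitute-assoc (β l) δ γ))))
    , λ l → trans (⊙-◃ δ γ γ◃d′≋d l) (δ◃d≋d l))

-- Linear orders in a sheaf topos

module SectionProperties {C : Category ℓ ℓ ℓ} (P : Presheaf C) where
  open Category C using (_∘_; id; _⇒_) renaming (_≈_ to _≈ᶜ_)
  open Sections P
  private
    module P = Functor P
  module _ {U : Category.Obj C} where
    open Setoid (P.F₀ U) public using (refl; sym; trans)

  ∣-cong : ∀ {U V} (f : V ⇒ U) {x y : Γ U} → x ≈ y → x ∣ f ≈ y ∣ f
  ∣-cong f = Func.cong (P.F₁ f)

  ∣-congʳ : ∀ {U V} {f g : V ⇒ U} (x : Γ U) → f ≈ᶜ g → x ∣ f ≈ x ∣ g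
  ∣-congʳ x p = P.F-resp-≈ p x

  ∣-id : ∀ {U} (x : Γ U) → x ∣ id ≈ x
  ∣-id = P.identity

  ∣-∘ : ∀ {U V W} (x : Γ U) (f : V ⇒ U) (g : W ⇒ V) → x ∣ (f ∘ g) ≈ x ∣ f ∣ g
  ∣-∘ x f g = P.homomorphism g f x

module LatticeObjectProperties {C : Category ℓ ℓ ℓ} {P : Presheaf C} (L : LatticeObject P) where
  open Category C using (_⇒_)
  open Sections P
  open SectionProperties P
  open LatticeObject L public using (sections)
  module _ {U : Category.Obj C} where
    open Unification (sections U) public
    open EvaluationProperties (sections U) public
  private
    module L = LatticeObject L
    module Lₛ {U} = BoundedDistributiveLattice (sections U)

  ⟦⟧-∣ : ∀ {U V} (f : V ⇒ U) {m} (t : Poly m) (d : Fin m → Γ U) →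
         ⟦ t ⟧ (λ i → d i ∣ f) ≈ ⟦ t ⟧ d ∣ f
  ⟦⟧-∣ f (var i) d = refl
  ⟦⟧-∣ f (s ∨ t) d = trans (Lₛ.∨-cong (⟦⟧-∣ f s d) (⟦⟧-∣ f t d))
                       (NaturalTransformation.commute L.join f _)
  ⟦⟧-∣ f (s ∧ t) d = trans (Lₛ.∧-cong (⟦⟧-∣ f s d) (⟦⟧-∣ f t d))
                       (NaturalTransformation.commute L.meet f _)
  ⟦⟧-∣ f ⊤       d = NaturalTransformation.commute L.top f tt
  ⟦⟧-∣ f ⊥       d = NaturalTransformation.commute L.bot f tt

module SiteProperties (S : Site ℓ j) where
  open Site S
  open Category category
  open Sieve

  infix 4 _⊆_
  _⊆_ : ∀ {U} → Sieve category U → Sieve category U → Set _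
  R ⊆ R′ = ∀ {V} (f : V ⇒ _) → R ∋ f → R′ ∋ f

  -- Pulled back along a member of `R`, the larger sieve contains the identity and is therefore
  -- maximal.
  covers-mono : ∀ {U} {R R′ : Sieve category U} → R ⊆ R′ → Covers R → Covers R′
  covers-mono {R′ = R′} R⊆R′ cov = transitive {R = R′} cov λ {_} {f} p →
    maximal (pullback f R′) (resp R′ (Equiv.sym (identityʳ f)) (R⊆R′ f p))

  Locally⇒Covers : ∀ {U} (R : Sieve category U) → Locally S U (R ∋_) → Covers R
  Locally⇒Covers R (_ , cov , R′⊆R) = covers-mono R′⊆R cov

  ⋂ : ∀ {n U} → (Fin n → Sieve category U) → Sieve category U
  ⋂ R = record
    { _∋_    = λ f → ∀ i → R i ∋ f
    ; resp   = λ p q i → resp (R i) p (q i)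
    ; closed = λ q g i → closed (R i) (q i) g
    }

  ⋂-covers : ∀ {n U} (R : Fin n → Sieve category U) → (∀ i → Covers (R i)) → Covers (⋂ R)
  ⋂-covers {zero}  R cov = maximal (⋂ R) λ ()
  ⋂-covers {suc n} R cov = transitive (cov zero) λ {_} {f} p →
    covers-mono {R′ = pullback f (⋂ R)}
      (λ { g q zero → closed (R zero) p g ; g q (suc i) → q i })
      (stable f (⋂-covers (λ i → R (suc i)) (λ i → cov (suc i))))

module _ {S : Site ℓ j} where

  -- Only meets are constructed by gluing; joins are the meets of this order.
  dual : LinearOrder S → LinearOrder S
  dual D = record
    { D              = D.D
    ; isSheaf        = D.isSheaf
    ; _≤_            = flip D._≤_
    ; ≤-restrict     = D.≤-restrict
    ; ≤-local        = λ cov x y p → D.≤-local cov y x p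
    ; isPartialOrder = λ U → Flip.isPartialOrder (D.isPartialOrder U)
    ; zero#          = D.one#
    ; one#           = D.zero#
    ; minimum        = D.maximum
    ; maximum        = D.minimum
    ; total          = λ x y → D.total y x
    ; distinct       = λ 1≈0 → D.distinct (IsPartialOrder.Eq.sym (D.isPartialOrder _) 1≈0)
    }
    where module D = LinearOrder D

module Meet {S : Site ℓ j} (D : LinearOrder S) where
  open Site S
  open Category category using (_⇒_; _∘_; id; Obj; module Equiv) renaming (_≈_ to _≈ᶜ_)
  open SiteProperties S
  open LinearOrder D using (_≤_; ≤-restrict; ≤-local; isPartialOrder; isSheaf) renaming (D to P)
  open Sections P
  open SectionProperties P
  open IsSheaf isSheaf
  open Sieve
  private
    module _ {U : Obj} where
      open IsPartialOrder (isPartialOrder U) public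
        using (antisym; ≤-respˡ-≈; ≤-respʳ-≈; reflexive)
        renaming (refl to ≤-refl; trans to ≤-trans)

  comparable : ∀ {U} → Γ U → Γ U → Sieve category U
  comparable x y = record
    { _∋_    = λ f → x ∣ f ≤ y ∣ f ⊎ y ∣ f ≤ x ∣ f
    ; resp   = λ p → Sum.map (respect x y p) (respect y x p)
    ; closed = λ q g → Sum.map (restrict x y g) (restrict y x g) q
    }
    where
    respect : ∀ {U V} {f g : V ⇒ U} (x y : Γ U) → f ≈ᶜ g →
              x ∣ f ≤ y ∣ f → x ∣ g ≤ y ∣ g
    respect x y p q = ≤-respˡ-≈ (∣-congʳ x p) (≤-respʳ-≈ (∣-congʳ y p) q)
    restrict : ∀ {U V W} {f : V ⇒ U} (x y : Γ U) (g : W ⇒ V) →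
               x ∣ f ≤ y ∣ f → x ∣ (f ∘ g) ≤ y ∣ (f ∘ g)
    restrict {f = f} x y g q =
      ≤-respˡ-≈ (sym (∣-∘ x f g)) (≤-respʳ-≈ (sym (∣-∘ y f g)) (≤-restrict g q))

  comparable-covers : ∀ {U} (x y : Γ U) → Covers (comparable x y)
  comparable-covers x y = Locally⇒Covers (comparable x y) (LinearOrder.total D x y)

  module _ {U : Obj} (x y : Γ U) where

    smaller : ∀ {V} (f : V ⇒ U) → comparable x y ∋ f → Γ V
    smaller f (inj₁ _) = x ∣ f
    smaller f (inj₂ _) = y ∣ f

    smaller-≤ˡ : ∀ {V} (f : V ⇒ U) p → smaller {V} f p ≤ x ∣ f
    smaller-≤ˡ f (inj₁ _)   = ≤-refl
    smaller-≤ˡ f (inj₂ y≤x) = y≤x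

    smaller-≤ʳ : ∀ {V} (f : V ⇒ U) p → smaller {V} f p ≤ y ∣ f
    smaller-≤ʳ f (inj₁ x≤y) = x≤y
    smaller-≤ʳ f (inj₂ _)   = ≤-refl

    smaller-greatest : ∀ {V} (f : V ⇒ U) p {z} → z ≤ x ∣ f → z ≤ y ∣ f → z ≤ smaller {V} f p
    smaller-greatest f (inj₁ _) z≤x z≤y = z≤x
    smaller-greatest f (inj₂ _) z≤x z≤y = z≤y

    -- The proofs `p` and `q` may select different arguments. Both selections are greatest lower
    -- bounds, which makes the choice irrelevant up to antisymmetry.
    smaller-mono : ∀ {V} {f g : V ⇒ U} p q → f ≈ᶜ g → smaller f p ≤ smaller g q
    smaller-mono {f = f} {g} p q f≈g = smaller-greatest g q
      (≤-respʳ-≈ (∣-congʳ x f≈g) (smaller-≤ˡ f p)) (≤-respʳ-≈ (∣-congʳ y f≈g) (smaller-≤ʳ f p))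

    smaller-family : MatchingFamily S P (comparable x y)
    smaller-family = record
      { at         = smaller
      ; at-cong    = λ f≈g p q → antisym (smaller-mono p q f≈g) (smaller-mono q p (Equiv.sym f≈g))
      -- `closed` keeps the side chosen by the proof, so only functoriality of restriction is left.
      ; compatible = λ { f (inj₁ _) g → ∣-∘ x f g ; f (inj₂ _) g → ∣-∘ y f g }
      }

    glued : Σ[ z ∈ Γ U ] (∀ {V} (f : V ⇒ U) p → z ∣ f ≈ smaller f p)
    glued = glue (comparable-covers x y) smaller-family

  infixr 7 _⊓_
  _⊓_ : ∀ {U} → Γ U → Γ U → Γ U
  x ⊓ y = proj₁ (glued x y)

  module _ {U : Obj} (x y : Γ U) where

    x⊓y≤x : x ⊓ y ≤ x
    x⊓y≤x = ≤-local (comparable-covers x y) _ _ λ f p →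
      ≤-respˡ-≈ (sym (proj₂ (glued x y) f p)) (smaller-≤ˡ x y f p)

    x⊓y≤y : x ⊓ y ≤ y
    x⊓y≤y = ≤-local (comparable-covers x y) _ _ λ f p →
      ≤-respˡ-≈ (sym (proj₂ (glued x y) f p)) (smaller-≤ʳ x y f p)

    -- Stated for a restricted meet so that `f = id` gives the infimum property and general `f`
    -- gives naturality and the local step of distributivity.
    ⊓∣-greatest : ∀ {V} (f : V ⇒ U) {z : Γ V} → z ≤ x ∣ f → z ≤ y ∣ f → z ≤ (x ⊓ y) ∣ f
    ⊓∣-greatest f z≤x z≤y = ≤-local (stable f (comparable-covers x y)) _ _ λ g p →
      ≤-respʳ-≈ (trans (sym (proj₂ (glued x y) (f ∘ g) p)) (∣-∘ _ f g))
        (smaller-greatest x y (f ∘ g) p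
          (≤-respʳ-≈ (sym (∣-∘ x f g)) (≤-restrict g z≤x))
          (≤-respʳ-≈ (sym (∣-∘ y f g)) (≤-restrict g z≤y)))

  ⊓-infimum : ∀ {U} → OrderTheoretic.Infimum (_≤_ {U}) _⊓_
  ⊓-infimum x y = x⊓y≤x x y , x⊓y≤y x y , λ z z≤x z≤y →
    ≤-respʳ-≈ (∣-id _) (⊓∣-greatest x y id
      (≤-respʳ-≈ (sym (∣-id x)) z≤x) (≤-respʳ-≈ (sym (∣-id y)) z≤y))

  private
    ⊓-greatest : ∀ {U} {x y z : Γ U} → z ≤ x → z ≤ y → z ≤ x ⊓ y
    ⊓-greatest z≤x z≤y = proj₂ (proj₂ (⊓-infimum _ _)) _ z≤x z≤y

  ⊓-mono : ∀ {U} {x x′ y y′ : Γ U} → x ≤ x′ → y ≤ y′ → x ⊓ y ≤ x′ ⊓ y′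
  ⊓-mono x≤x′ y≤y′ = ⊓-greatest (≤-trans (x⊓y≤x _ _) x≤x′) (≤-trans (x⊓y≤y _ _) y≤y′)

  ⊓-cong : ∀ {U} {x x′ y y′ : Γ U} → x ≈ x′ → y ≈ y′ → x ⊓ y ≈ x′ ⊓ y′
  ⊓-cong x≈x′ y≈y′ = antisym (⊓-mono (reflexive x≈x′) (reflexive y≈y′))
                             (⊓-mono (reflexive (sym x≈x′)) (reflexive (sym y≈y′)))

  ⊓-natural : NaturalTransformation (P ×ᵖ P) P
  ⊓-natural = record
    { η       = λ _ → record { to = λ (x , y) → x ⊓ y ; cong = λ (p , q) → ⊓-cong p q }
    ; commute = λ f (x , y) → antisym
        (⊓∣-greatest x y f (x⊓y≤x _ _) (x⊓y≤y _ _))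
        (⊓-greatest (≤-restrict f (x⊓y≤x x y)) (≤-restrict f (x⊓y≤y x y)))
    }

  x≤y⇒x⊓y≈x : ∀ {U} {x y : Γ U} → x ≤ y → x ⊓ y ≈ x
  x≤y⇒x⊓y≈x x≤y = antisym (x⊓y≤x _ _) (⊓-greatest ≤-refl x≤y)

  x≥y⇒x⊓y≈y : ∀ {U} {x y : Γ U} → y ≤ x → x ⊓ y ≈ y
  x≥y⇒x⊓y≈y y≤x = antisym (x⊓y≤y _ _) (⊓-greatest y≤x ≤-refl)

module _ {S : Site ℓ j} (D : LinearOrder S) where
  open Site S
  open Category category using (_⇒_; Obj; identityʳ; module Equiv)
  open SiteProperties S
  open LinearOrder D using (_≤_; ≤-restrict; ≤-local; isPartialOrder; minimum; maximum; zero#; one#)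
    renaming (D to P)
  open Sections P
  open SectionProperties P
  open Meet D
  open Meet (dual D) using ()
    renaming ( _⊓_ to infixr 6 _⊔_; ⊓-infimum to ⊔-supremum; ⊓-natural to ⊔-natural
             ; x≤y⇒x⊓y≈x to x≥y⇒x⊔y≈x; x≥y⇒x⊓y≈y to x≤y⇒x⊔y≈y; ⊓∣-greatest to ⊔∣-least)

  private
    latticeAt : ∀ U → OrderTheoretic.Lattice ℓ ℓ ℓ
    latticeAt U = record
      { isLattice = record
        { isPartialOrder = isPartialOrder U
        ; supremum       = ⊔-supremum
        ; infimum        = ⊓-infimum
        }
      }

    module _ {U : Obj} where
      open OrderTheoretic.Lattice (latticeAt U) public
        using (antisym; ∨-least; ∧-greatest; x∧y≤x; x∧y≤y; x≤x∨y; y≤x∨y)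
        renaming (refl to ≤-refl; trans to ≤-trans)

  -- One inequality holds in every lattice. The other is local, and where `y` and `z` are comparable
  -- their join is one of them.
  ⊓-distribˡ-⊔ : ∀ {U} (x y z : Γ U) → x ⊓ (y ⊔ z) ≈ (x ⊓ y) ⊔ (x ⊓ z)
  ⊓-distribˡ-⊔ {U} x y z = antisym
    (≤-local (comparable-covers y z) _ _ λ f → λ
      { (inj₁ y≤z) → ≤-trans (below z f y≤z ≤-refl) (≤-restrict f (y≤x∨y (x ⊓ y) (x ⊓ z)))
      ; (inj₂ z≤y) → ≤-trans (below y f ≤-refl z≤y) (≤-restrict f (x≤x∨y (x ⊓ y) (x ⊓ z)))
      })
    (∨-least (∧-greatest (x∧y≤x x y) (≤-trans (x∧y≤y x y) (x≤x∨y y z)))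
             (∧-greatest (x∧y≤x x z) (≤-trans (x∧y≤y x z) (y≤x∨y y z))))
    where
    below : ∀ {V} (w : Γ U) (f : V ⇒ U) → y ∣ f ≤ w ∣ f → z ∣ f ≤ w ∣ f →
            (x ⊓ (y ⊔ z)) ∣ f ≤ (x ⊓ w) ∣ f
    below w f y≤w z≤w = ⊓∣-greatest x w f (≤-restrict f (x∧y≤x x (y ⊔ z)))
      (≤-trans (≤-restrict f (x∧y≤y x (y ⊔ z))) (⊔∣-least y z f y≤w z≤w))

  private
    distributiveLatticeAt : ∀ U → OrderTheoretic.DistributiveLattice ℓ ℓ ℓ
    distributiveLatticeAt U = record
      { isDistributiveLattice = record
        { isLattice    = OrderTheoretic.Lattice.isLattice (latticeAt U)
        ; ∧-distribˡ-∨ = ⊓-distribˡ-⊔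
        }
      }

  minMaxLattice : MinMaxLattice D
  minMaxLattice = record
    { lattice = record
      { meet = ⊓-natural
      ; join = ⊔-natural
      ; top  = one#
      ; bot  = zero#
      ; isBoundedDistributiveLattice = λ U → record
        { isDistributiveLattice = record
          { isLattice   = OrderLatticeProperties.isAlgLattice (latticeAt U)
          ; ∨-distrib-∧ = DistributiveProperties.∨-distrib-∧ (distributiveLatticeAt U)
          ; ∧-distrib-∨ = DistributiveProperties.∧-distrib-∨ (distributiveLatticeAt U)
          }
        ; ∧-identityˡ = λ x → x≥y⇒x⊓y≈y (maximum U x)
        ; ∨-identityˡ = λ x → x≤y⇒x⊔y≈y (minimum U x)
        }
      }
    ; x≤y⇒x⋏y≈x = x≤y⇒x⊓y≈x
    ; x≥y⇒x⋏y≈y = x≥y⇒x⊓y≈y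
    ; x≤y⇒x⋎y≈y = x≤y⇒x⊔y≈y
    ; x≥y⇒x⋎y≈x = x≥y⇒x⊔y≈x
    ; 0≈0 = refl
    ; 1≈1 = refl
    }

  module _ (M : MinMaxLattice D) where
    private module M = MinMaxLattice M
    open LatticeObjectProperties M.lattice using (_◃_; Unifiable; chain-unifiable; ⟦⟧-∣)
      renaming (_≤_ to _≤ᴹ_)

    ≤⇒≤ᴹ : ∀ {U} {x y : Γ U} → x ≤ y → x ≤ᴹ y
    ≤⇒≤ᴹ x≤y = sym (M.x≤y⇒x⋏y≈x x≤y)

    ◃-∣ : ∀ {n m U V} (α : Fin n → Poly m) (d : Fin m → Γ U) (f : V ⇒ U) i →
          (α ◃ λ k → d k ∣ f) i ≈ (α ◃ d) i ∣ f
    ◃-∣ α d f i = ⟦⟧-∣ f (α i) d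

    unifiable : ∀ {n m U} (α β : Fin n → Poly m) (d : Fin m → Γ U) → Sieve category U
    unifiable α β d = record
      { _∋_    = λ f → Unifiable α β (λ i → d i ∣ f)
      ; resp   = λ f≈g (k , γ , d′ , αγ≃βγ , γ◃d′≋d) →
          k , γ , d′ , αγ≃βγ , λ i → trans (γ◃d′≋d i) (∣-congʳ (d i) f≈g)
      ; closed = λ {_} {_} {f} (k , γ , d′ , αγ≃βγ , γ◃d′≋d) g →
          k , γ , (λ i → d′ i ∣ g) , αγ≃βγ , λ i →
            trans (◃-∣ γ d′ g i) (trans (∣-cong g (γ◃d′≋d i)) (sym (∣-∘ (d i) f g)))
      }

    flat : IsFlat S M.lattice
    flat {m = m} α β U d αd≋βd =
      good , transitive {R = good} chain-covers locally-good , λ f p → p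
      where
      good : Sieve category U
      good = unifiable α β d

      chain : Sieve category U
      chain = ⋂ λ i → ⋂ λ k → comparable (d i) (d k)

      chain-covers : Covers chain
      chain-covers = ⋂-covers _ λ i → ⋂-covers _ λ k → comparable-covers (d i) (d k)

      locally-good : ∀ {V} {f : V ⇒ U} → Sieve._∋_ chain f → Covers (pullback f good)
      locally-good {f = f} p with chain-unifiable m α β (λ i → d i ∣ f)
          (λ i k → Sum.map ≤⇒≤ᴹ ≤⇒≤ᴹ (p i k))
          (λ i → trans (◃-∣ α d f i) (trans (∣-cong f (αd≋βd i)) (sym (◃-∣ β d f i))))
      ... | inj₁ 0≈1 =
        -- The cover `R` has no members, so it is contained in every sieve.
        let R , cov , R⊆∅ = LinearOrder.distinct D (trans (sym M.0≈0) (trans 0≈1 M.1≈1))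
        in Locally⇒Covers (pullback f good) (R , cov , λ g p → ⊥-elim (R⊆∅ g p))
      ... | inj₂ u = maximal (pullback f good) (Sieve.resp good (Equiv.sym (identityʳ f)) u)

-- The geometric morphism of a lattice object with projective sections

-- A presentation of `L` as a retract of `DL rank`: `section` is a homomorphism, and evaluation at
-- `generator` is a retraction of it. Such `L` are the finitely generated projective distributive
-- lattices.
record Projective (L : BoundedDistributiveLattice 0ℓ 0ℓ) : Set where
  open BoundedDistributiveLattice L using (Carrier; _≈_)
  private module L = BoundedDistributiveLattice L
  open Evaluation L using (⟦_⟧)
  field
    rank         : ℕ
    generator    : Fin rank → Carrier
    section      : Carrier → Poly rank
    section-cong : ∀ {x y} → x ≈ y → section x ≃ section y
    section-∨    : ∀ x y → section (x L.∨ y) ≃ section x ∨ section y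
    section-∧    : ∀ x y → section (x L.∧ y) ≃ section x ∧ section y
    section-⊤    : section L.⊤ ≃ ⊤
    section-⊥    : section L.⊥ ≃ ⊥
    retract      : ∀ x → ⟦ section x ⟧ generator ≈ x

  section-⟦⟧ : ∀ {m} (t : Poly m) (d : Fin m → Carrier) →
               substitute t (section ∘′ d) ≃ section (⟦ t ⟧ d)
  section-⟦⟧ (var i) d = ≃-refl
  section-⟦⟧ (s ∨ t) d = ≃-trans (∨-cong (section-⟦⟧ s d) (section-⟦⟧ t d)) (≃-sym (section-∨ _ _))
  section-⟦⟧ (s ∧ t) d = ≃-trans (∧-cong (section-⟦⟧ s d) (section-⟦⟧ t d)) (≃-sym (section-∧ _ _))
  section-⟦⟧ ⊤       d = ≃-sym section-⊤
  section-⟦⟧ ⊥       d = ≃-sym section-⊥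

module _ {C : Category 0ℓ 0ℓ 0ℓ} where
  open Category C using (_⇒_)
  open NaturalTransformation using (η)

  element : (X : Presheaf C) {U : Category.Obj C} → Sections.Γ X U → NaturalTransformation (よ U) X
  element X x = record
    { η       = λ V → record { to = x ∣_ ; cong = ∣-congʳ x }
    ; commute = λ f g → ∣-∘ x g f
    }
    where
    open Sections X
    open SectionProperties X

  -- The limit is given only by its universal property. Testing it on cones with apex `よ U`
  -- identifies the sections of the apex over `U` with compatible families.
  module PresheafLimit {J : Category 0ℓ 0ℓ 0ℓ} {F : Functor J (Presheaves C)}
                       (L : Cone F) (isLimit : IsLimit L) where
    private
      module J = Category J
      module F = Functor F
      module L = Cone L
      module FX {X} = SectionProperties (F.F₀ X)
      module _ {X : J.Obj} where
        open Sections (F.F₀ X) public using (_≈_)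
    open Sections L.apex using () renaming (Γ to Γₗ; _≈_ to _≈ₗ_)
    open SectionProperties L.apex using (sym; trans; ∣-id)

    π : ∀ X {U} → Γₗ U → Sections.Γ (F.F₀ X) U
    π X {U} z = η (L.π X) U ⟨$⟩ z

    Compatible : ∀ {U} → (∀ X → Sections.Γ (F.F₀ X) U) → Set
    Compatible {U} x = ∀ {X Y} (f : X J.⇒ Y) → η (F.F₁ f) U ⟨$⟩ x X ≈ x Y

    private
      cone : ∀ {U} (x : ∀ X → Sections.Γ (F.F₀ X) U) → Compatible x → Cone F
      cone {U} x compatible = record
        { apex    = よ U
        ; π       = λ X → element (F.F₀ X) (x X)
        ; commute = λ f V g → FX.trans (NaturalTransformation.commute (F.F₁ f) g (x _))
                                       (FX.∣-cong g (compatible f))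
        }

    module _ {U} (x : ∀ X → Sections.Γ (F.F₀ X) U) (compatible : Compatible x) where

      tuple : Γₗ U
      tuple = η (proj₁ (isLimit (cone x compatible))) U ⟨$⟩ Category.id C

      π-tuple : ∀ X → π X tuple ≈ x X
      π-tuple X = FX.trans (proj₁ (proj₂ (isLimit (cone x compatible))) X U (Category.id C))
                           (FX.∣-id (x X))

      tuple-unique : ∀ z → (∀ X → π X z ≈ x X) → z ≈ₗ tuple
      tuple-unique z πz≈x = trans (sym (∣-id z))
        (proj₂ (proj₂ (isLimit (cone x compatible))) (element L.apex z)
          (λ X V g → FX.trans (NaturalTransformation.commute (L.π X) g z) (FX.∣-cong g (πz≈x X)))
          U (Category.id C))

    π-injective : ∀ {U} (y z : Γₗ U) → (∀ X → π X y ≈ π X z) → y ≈ₗ z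
    π-injective {U} y z p = trans (tuple-unique x compatible y p)
                                  (sym (tuple-unique x compatible z λ X → FX.refl))
      where
      x : ∀ X → Sections.Γ (F.F₀ X) U
      x X = π X z
      compatible : Compatible x
      compatible f = L.commute f U z

module InverseImage {C : Category 0ℓ 0ℓ 0ℓ} {P : Presheaf C} (L : LatticeObject P)
                    (projective : ∀ U → Projective (LatticeObject.sections L U)) where
  open Category C using (_⇒_; Obj)
  open Sections P
  open SectionProperties P
  open LatticeObjectProperties L
  open NaturalTransformation using (η)
  private
    module Pr (U : Obj) = Projective (projective U)

  rank : Obj → ℕ
  rank U = Pr.rank U

  generator : ∀ {U} → Fin (rank U) → Γ U
  generator {U} = Pr.generator U

  -- A tuple `d` is a homomorphism from `DL m` to `sections U`; followed by the section into
  -- `DL (rank U)` it is a morphism from `rank U` to `m` in `□`.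
  ⌜_⌝ : ∀ {U m} → (Fin m → Γ U) → (Fin m → Poly (rank U))
  ⌜_⌝ {U} d i = Pr.section U (d i)

  ⌜⌝-cong : ∀ {U m} {d d′ : Fin m → Γ U} → d ≋ d′ → ⌜ d ⌝ ≃* ⌜ d′ ⌝
  ⌜⌝-cong {U} p i = Pr.section-cong U (p i)

  ⊙-⌜⌝ : ∀ {U n m} (α : Fin n → Poly m) (d : Fin m → Γ U) → α ⊙ ⌜ d ⌝ ≃* ⌜ α ◃ d ⌝
  ⊙-⌜⌝ {U} α d i = Pr.section-⟦⟧ U (α i) d

  ⌜⌝-◃-generator : ∀ {U m} (d : Fin m → Γ U) → ⌜ d ⌝ ◃ generator ≋ d
  ⌜⌝-◃-generator {U} d i = Pr.retract U (d i)

  infixl 10 _∣*_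
  _∣*_ : ∀ {U V m} → (Fin m → Γ U) → V ⇒ U → (Fin m → Γ V)
  (d ∣* f) i = d i ∣ f

  -- For `d` itself a restriction of `generator`, this says that sending `f` to `⌜ generator ∣* f ⌝`
  -- respects composition. Identities go to the idempotents `⌜ generator ⌝`, so the functor lands in
  -- the idempotent completion of `□`.
  ⌜⌝-⊙-⌜generator∣⌝ : ∀ {U V m} (d : Fin m → Γ U) (f : V ⇒ U) →
                      ⌜ d ⌝ ⊙ ⌜ generator ∣* f ⌝ ≃* ⌜ d ∣* f ⌝
  ⌜⌝-⊙-⌜generator∣⌝ d f i = ≃-trans (⊙-⌜⌝ ⌜ d ⌝ (generator ∣* f) i)
    (⌜⌝-cong (λ k → trans (⟦⟧-∣ f (⌜ d ⌝ k) generator) (∣-cong f (⌜⌝-◃-generator d k))) i)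

  ⌜⌝-⊙-⌜generator⌝ : ∀ {U m} (d : Fin m → Γ U) → ⌜ d ⌝ ⊙ ⌜ generator ⌝ ≃* ⌜ d ⌝
  ⌜⌝-⊙-⌜generator⌝ d i = ≃-trans (⊙-⌜⌝ ⌜ d ⌝ generator i) (⌜⌝-cong (⌜⌝-◃-generator d) i)

  -- ⌜ generator ⌝ is an idempotent of rank U in □, and sections U is its splitting.
  module Fixed (X : Presheaf □) where
    open Sections X using () renaming (Γ to ΓX; _∣_ to _∣ˣ_; _≈_ to _≈ˣ_)
    private module X = SectionProperties X

    IsFixed : ∀ U → ΓX (rank U) → Set
    IsFixed U x = x ∣ˣ ⌜ generator {U} ⌝ ≈ˣ x

    ∣⌜⌝-fixed : ∀ {U m} (x : ΓX m) (d : Fin m → Γ U) → IsFixed U (x ∣ˣ ⌜ d ⌝)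
    ∣⌜⌝-fixed x d = X.trans (X.sym (X.∣-∘ x ⌜ d ⌝ ⌜ generator ⌝)) (X.∣-congʳ x (⌜⌝-⊙-⌜generator⌝ d))

    presheaf : Presheaf C
    presheaf = record
      { F₀ = λ U → record
        { Carrier       = Σ[ x ∈ ΓX (rank U) ] IsFixed U x
        ; _≈_           = λ x y → proj₁ x ≈ˣ proj₁ y
        ; isEquivalence = On.isEquivalence proj₁ (Setoid.isEquivalence (Functor.F₀ X (rank U)))
        }
      ; F₁ = λ f → record
        { to   = λ (x , _) → x ∣ˣ ⌜ generator ∣* f ⌝ , ∣⌜⌝-fixed x (generator ∣* f)
        ; cong = X.∣-cong ⌜ generator ∣* f ⌝
        }
      ; identity     = λ (x , x-fixed) →
          X.trans (X.∣-congʳ x (⌜⌝-cong λ i → ∣-id (generator i))) x-fixed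
      ; homomorphism = λ g f (x , _) → X.trans
          (X.∣-congʳ x λ i → ≃-trans (⌜⌝-cong (λ k → ∣-∘ (generator k) f g) i)
                                     (≃-sym (⌜⌝-⊙-⌜generator∣⌝ (generator ∣* f) g i)))
          (X.∣-∘ x ⌜ generator ∣* f ⌝ ⌜ generator ∣* g ⌝)
      ; F-resp-≈     = λ p (x , _) → X.∣-congʳ x (⌜⌝-cong λ i → ∣-congʳ (generator i) p)
      }

  inverseImage : Functor (Presheaves □) (Presheaves C)
  inverseImage = record
    { F₀ = Fixed.presheaf
    ; F₁ = λ {X} {Y} h → let module Y = SectionProperties Y in record
      { η = λ U → record
        { to   = λ (x , x-fixed) → η h (rank U) ⟨$⟩ x ,
            Y.trans (Y.sym (NaturalTransformation.commute h ⌜ generator ⌝ x))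
                    (Func.cong (η h (rank U)) x-fixed)
        ; cong = Func.cong (η h (rank U))
        }
      ; commute = λ f (x , _) → NaturalTransformation.commute h ⌜ generator ∣* f ⌝ x
      }
    ; identity     = λ {X} U x → SectionProperties.refl X
    ; homomorphism = λ {_} {_} {Z} g f U x → SectionProperties.refl Z
    ; F-resp-≈     = λ p U (x , _) → p (rank U) x
    }

  -- A compatible family of fixed elements over `rank U` lifts to the given limit. The lift is fixed
  -- because its restriction along `⌜ generator ⌝` has the same projections as the lift itself.
  inverseImage-lex : PreservesFiniteLimits inverseImage
  inverseImage-lex J _ F L isLimit K = u , factors , unique
    where
    open PresheafLimit L isLimit
    open Fixed (Cone.apex L)
    open Category (Presheaves C) using () renaming (_≈_ to _≈ˆ_; _∘_ to _∘ˆ_)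
    open Sections (Cone.apex L) using () renaming (Γ to Γₗ; _∣_ to _∣ₗ_; _≈_ to _≈ₗ_)
    module K = Cone K
    open Sections K.apex using () renaming (Γ to Γₖ; _∣_ to _∣ₖ_)
    module FX {X : Category.Obj J} where
      open Sections (Functor.F₀ F X) public
      open SectionProperties (Functor.F₀ F X) public

    component : ∀ {U} → Γₖ U → ∀ X → FX.Γ {X} (rank U)
    component {U} z X = proj₁ (η (K.π X) U ⟨$⟩ z)

    component-compatible : ∀ {U} (z : Γₖ U) → Compatible (component z)
    component-compatible {U} z f = K.commute f U z

    mediate : ∀ {U} → Γₖ U → Γₗ (rank U)
    mediate z = tuple (component z) (component-compatible z)

    mediate-unique : ∀ {U} (z : Γₖ U) y → (∀ X → π X y FX.≈ component z X) → y ≈ₗ mediate z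
    mediate-unique z = tuple-unique (component z) (component-compatible z)

    π-mediate : ∀ {U} (z : Γₖ U) X → π X (mediate z) FX.≈ component z X
    π-mediate z = π-tuple (component z) (component-compatible z)

    π-mediate-∣ : ∀ {U m} (z : Γₖ U) (α : Fin (rank U) → Poly m) X →
                  π X (mediate z ∣ₗ α) FX.≈ (component z X FX.∣ α)
    π-mediate-∣ z α X = FX.trans (NaturalTransformation.commute (Cone.π L X) α (mediate z))
                                 (FX.∣-cong α (π-mediate z X))

    mediate-fixed : ∀ {U} (z : Γₖ U) → IsFixed U (mediate z)
    mediate-fixed {U} z = mediate-unique z _ λ X →
      FX.trans (π-mediate-∣ z ⌜ generator ⌝ X) (proj₂ (η (K.π X) U ⟨$⟩ z))

    u : NaturalTransformation K.apex presheaf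
    u = record
      { η = λ U → record
        { to   = λ z → mediate z , mediate-fixed z
        ; cong = λ {y} {z} y≈z → mediate-unique z (mediate y) λ X →
            FX.trans (π-mediate y X) (Func.cong (η (K.π X) U) y≈z)
        }
      ; commute = λ f z → SectionProperties.sym (Cone.apex L) (mediate-unique (z ∣ₖ f) _ λ X →
          FX.trans (π-mediate-∣ z ⌜ generator ∣* f ⌝ X)
                   (FX.sym (NaturalTransformation.commute (K.π X) f z)))
      }

    factors : ∀ X → Functor.F₁ inverseImage (Cone.π L X) ∘ˆ u ≈ˆ K.π X
    factors X U z = π-mediate z X

    unique : ∀ v → (∀ X → Functor.F₁ inverseImage (Cone.π L X) ∘ˆ v ≈ˆ K.π X) → v ≈ˆ u
    unique v p U z = mediate-unique z _ λ X → p X U z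

  power : ℕ → Presheaf C
  power m = record
    { F₀ = λ U → record
      { Carrier       = Fin m → Γ U
      ; _≈_           = _≋_
      ; isEquivalence = record
        { refl  = λ _ → refl
        ; sym   = λ p i → sym (p i)
        ; trans = λ p q i → trans (p i) (q i)
        }
      }
    ; F₁ = λ f → record { to = _∣* f ; cong = λ p i → ∣-cong f (p i) }
    ; identity     = λ d i → ∣-id (d i)
    ; homomorphism = λ g f d i → ∣-∘ (d i) f g
    ; F-resp-≈     = λ p d i → ∣-congʳ (d i) p
    }

  act : ∀ {k m} → (Fin m → Poly k) → NaturalTransformation (power k) (power m)
  act α = record
    { η       = λ U → record { to = α ◃_ ; cong = λ p i → ⟦⟧-congʳ (α i) p }
    ; commute = λ f d i → ⟦⟧-∣ f (α i) d
    }

  directImage : Functor (Presheaves C) (Presheaves □)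
  directImage = record
    { F₀ = λ Y → let module Y = SectionProperties Y in record
      { F₀ = λ m → homSetoid (power m) Y
      ; F₁ = λ α → record { to = _∘N act α ; cong = λ p U d → p U (α ◃ d) }
      ; identity     = λ τ U d → Y.refl
      ; homomorphism = λ γ α τ U d → Func.cong (η τ U) (⊙-◃ α γ λ _ → refl)
      ; F-resp-≈     = λ p τ U d → Func.cong (η τ U) λ i → ⟦⟧-congˡ (p i) d
      }
    ; F₁ = λ {Y} {Z} h → record
      { η       = λ m → record { to = h ∘N_ ; cong = λ p U d → Func.cong (η h U) (p U d) }
      ; commute = λ α τ U d → SectionProperties.refl Z
      }
    ; identity     = λ {Y} m τ U d → SectionProperties.refl Y
    ; homomorphism = λ {_} {_} {Z} g f m τ U d → SectionProperties.refl Z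
    ; F-resp-≈     = λ p m τ U d → p U (η τ U ⟨$⟩ d)
    }
    where open Category (Presheaves C) using (homSetoid)

  module _ (X : Presheaf □) where
    open Fixed X
    private module X = SectionProperties X

    realize : ∀ {m} → Sections.Γ X m → NaturalTransformation (power m) presheaf
    realize x = record
      { η = λ U → record
        { to   = λ d → Sections._∣_ X x ⌜ d ⌝ , ∣⌜⌝-fixed x d
        ; cong = λ p → X.∣-congʳ x (⌜⌝-cong p)
        }
      ; commute = λ f d → X.trans (X.∣-congʳ x λ i → ≃-sym (⌜⌝-⊙-⌜generator∣⌝ d f i))
                                  (X.∣-∘ x ⌜ d ⌝ ⌜ generator ∣* f ⌝)
      }

  -- The counit evaluates at `generator`, from which every tuple `d` is recovered by applying
  -- `⌜ d ⌝`: this is `zag`. The identity `zig` is exactly the condition of being fixed.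
  adjunction : inverseImage ⊣ directImage
  adjunction = record
    { unit = record
      { η = λ X → let module X = SectionProperties X in record
        { η = λ m → record
          { to   = realize X
          ; cong = λ p U d → X.∣-cong ⌜ d ⌝ p
          }
        ; commute = λ α x U d → X.trans (X.sym (X.∣-∘ x α ⌜ d ⌝)) (X.∣-congʳ x (⊙-⌜⌝ α d))
        }
      ; commute = λ {X} {Y} h m x U d →
          SectionProperties.sym Y (NaturalTransformation.commute h ⌜ d ⌝ x)
      }
    ; counit = record
      { η = λ Y → record
        { η = λ U → record
          { to   = λ (τ , _) → η τ U ⟨$⟩ generator
          ; cong = λ p → p U generator
          }
        ; commute = λ {U} {V} f (τ , _) → SectionProperties.trans Y
            (Func.cong (η τ V) (⌜⌝-◃-generator (generator ∣* f)))
            (NaturalTransformation.commute τ f generator)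
        }
      ; commute = λ {Y} {Z} h U τ → SectionProperties.refl Z
      }
    ; zig = λ X U (x , x-fixed) → x-fixed
    ; zag = λ Y m τ U d → Func.cong (η τ U) (⌜⌝-◃-generator d)
    }

  geometricMorphism : GeometricMorphism (Presheaves C) (Presheaves □)
  geometricMorphism = record
    { inverseImage = inverseImage
    ; directImage  = directImage
    ; adjunction   = adjunction
    ; lex          = inverseImage-lex
    }

  -- The fixed polynomials are exactly the image of `section`, where evaluation at `generator` is
  -- its inverse.
  classifies : Classifies geometricMorphism L
  classifies = record
    { iso = record
      { to = record
        { η = λ U → record { to = λ (t , _) → ⟦ t ⟧ generator ; cong = λ p → ⟦⟧-congˡ p generator }
        ; commute = λ f (t , _) → trans
            (⊙-◃ {n = 1} (λ _ → t) ⌜ generator ∣* f ⌝ (⌜⌝-◃-generator (generator ∣* f)) zero)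
            (⟦⟧-∣ f t generator)
        }
      ; from = record
        { η = λ U → record
          { to   = λ x → Pr.section U x ,
              ≃-trans (Pr.section-⟦⟧ U (Pr.section U x) generator)
                      (Pr.section-cong U (Pr.retract U x))
          ; cong = Pr.section-cong U
          }
        ; commute = λ f x → ≃-sym (⌜⌝-⊙-⌜generator∣⌝ {m = 1} (λ _ → x) f zero)
        }
      ; isoˡ = λ U (t , t-fixed) → ≃-trans (≃-sym (Pr.section-⟦⟧ U t generator)) t-fixed
      ; isoʳ = λ U x → Pr.retract U x
      }
    ; preserves-meet = λ U x → refl
    ; preserves-join = λ U x → refl
    ; preserves-top  = λ U x → refl
    ; preserves-bot  = λ U x → refl
    }

-- Uniqueness of the classifying morphism

module CategoryProperties (C : Category o h e) where
  open Category C
  open Equiv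
  private
    variable
      X Y Z W : Obj

  module HomReasoning {X Y : Obj} = SetoidReasoning (homSetoid X Y)

  ∘-congˡ : {f : Y ⇒ Z} {g g′ : X ⇒ Y} → g ≈ g′ → f ∘ g ≈ f ∘ g′
  ∘-congˡ = ∘-resp-≈ refl

  ∘-congʳ : {f f′ : Y ⇒ Z} {g : X ⇒ Y} → f ≈ f′ → f ∘ g ≈ f′ ∘ g
  ∘-congʳ p = ∘-resp-≈ p refl

  assoc⁻¹ : (k : Z ⇒ W) (g : Y ⇒ Z) (f : X ⇒ Y) → k ∘ (g ∘ f) ≈ (k ∘ g) ∘ f
  assoc⁻¹ k g f = sym (assoc k g f)

module Transposition {C : Category o h e} {D : Category o′ h′ e′}
                     {L : Functor C D} {R : Functor D C} (adj : L ⊣ R) where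
  private
    module C where
      open Category C public
      open CategoryProperties C public
    module D where
      open Category D public
      open CategoryProperties D public
    module L = Functor L
    module R = Functor R
    module unit   = NaturalTransformation (_⊣_.unit adj)
    module counit = NaturalTransformation (_⊣_.counit adj)
    open _⊣_ adj using (zig)

  adjunct : ∀ {A B} → L.F₀ A D.⇒ B → A C.⇒ R.F₀ B
  adjunct f = R.F₁ f C.∘ unit.η _

  coadjunct : ∀ {A B} → A C.⇒ R.F₀ B → L.F₀ A D.⇒ B
  coadjunct f = counit.η _ D.∘ L.F₁ f

  adjunct-cong : ∀ {A B} {f g : L.F₀ A D.⇒ B} → f D.≈ g → adjunct f C.≈ adjunct g
  adjunct-cong p = C.∘-congʳ (R.F-resp-≈ p)

  coadjunct-cong : ∀ {A B} {f g : A C.⇒ R.F₀ B} → f C.≈ g → coadjunct f D.≈ coadjunct g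
  coadjunct-cong p = D.∘-congˡ (L.F-resp-≈ p)

  adjunct-∘ : ∀ {A A′ B} (f : L.F₀ A D.⇒ B) (k : A′ C.⇒ A) →
              adjunct f C.∘ k C.≈ adjunct (f D.∘ L.F₁ k)
  adjunct-∘ f k = begin
    (R.F₁ f C.∘ unit.η _) C.∘ k              ≈⟨ C.assoc _ _ _ ⟩
    R.F₁ f C.∘ (unit.η _ C.∘ k)              ≈⟨ C.∘-congˡ (unit.commute k) ⟩
    R.F₁ f C.∘ (R.F₁ (L.F₁ k) C.∘ unit.η _)  ≈⟨ C.assoc⁻¹ _ _ _ ⟩
    (R.F₁ f C.∘ R.F₁ (L.F₁ k)) C.∘ unit.η _  ≈⟨ C.∘-congʳ (R.homomorphism f (L.F₁ k)) ⟨
    R.F₁ (f D.∘ L.F₁ k) C.∘ unit.η _         ∎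
    where open C.HomReasoning

  coadjunct-∘ : ∀ {A A′ B} (f : A C.⇒ R.F₀ B) (k : A′ C.⇒ A) →
                coadjunct f D.∘ L.F₁ k D.≈ coadjunct (f C.∘ k)
  coadjunct-∘ f k = D.Equiv.trans (D.assoc _ _ _) (D.∘-congˡ (D.Equiv.sym (L.homomorphism f k)))

  coadjunct-adjunct : ∀ {A B} (f : L.F₀ A D.⇒ B) → coadjunct (adjunct f) D.≈ f
  coadjunct-adjunct f = begin
    counit.η _ D.∘ L.F₁ (R.F₁ f C.∘ unit.η _)          ≈⟨ D.∘-congˡ (L.homomorphism _ _) ⟩
    counit.η _ D.∘ (L.F₁ (R.F₁ f) D.∘ L.F₁ (unit.η _)) ≈⟨ D.assoc⁻¹ _ _ _ ⟩
    (counit.η _ D.∘ L.F₁ (R.F₁ f)) D.∘ L.F₁ (unit.η _) ≈⟨ D.∘-congʳ (counit.commute f) ⟩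
    (f D.∘ counit.η _) D.∘ L.F₁ (unit.η _)             ≈⟨ D.assoc _ _ _ ⟩
    f D.∘ (counit.η _ D.∘ L.F₁ (unit.η _))             ≈⟨ D.∘-congˡ (zig _) ⟩
    f D.∘ D.id                                         ≈⟨ D.identityʳ f ⟩
    f                                                  ∎
    where open D.HomReasoning

  adjunct-injective : ∀ {A B} {f g : L.F₀ A D.⇒ B} → adjunct f C.≈ adjunct g → f D.≈ g
  adjunct-injective {f = f} {g} p = begin
    f                     ≈⟨ coadjunct-adjunct f ⟨
    coadjunct (adjunct f) ≈⟨ coadjunct-cong p ⟩
    coadjunct (adjunct g) ≈⟨ coadjunct-adjunct g ⟩
    g                     ∎
    where open D.HomReasoning

module _ {C : Category o h e} {D : Category o′ h′ e′} {F G : Functor C D} where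
  private
    module F = Functor F
    module G = Functor G
  open Category D
  open CategoryProperties D
  open NaturalTransformation using (η; commute)

  -- A pointwise inverse is automatically natural. This spares a direct proof that `κ` below is
  -- natural in `X`.
  invertNatural : (α : NaturalTransformation F G) (β : ∀ X → G.F₀ X ⇒ F.F₀ X) →
                  (∀ X → β X ∘ η α X ≈ id) → (∀ X → η α X ∘ β X ≈ id) → Iso (Functors C D) F G
  invertNatural α β βα≈id αβ≈id = record
    { to   = α
    ; from = record { η = β ; commute = natural }
    ; isoˡ = βα≈id
    ; isoʳ = αβ≈id
    }
    where
    open HomReasoning
    natural : ∀ {X Y} (f : Category._⇒_ C X Y) → β Y ∘ G.F₁ f ≈ F.F₁ f ∘ β X
    natural {X} {Y} f = begin
      β Y ∘ G.F₁ f                         ≈⟨ ∘-congˡ (identityʳ _) ⟨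
      β Y ∘ (G.F₁ f ∘ id)                  ≈⟨ ∘-congˡ (∘-congˡ (αβ≈id X)) ⟨
      β Y ∘ (G.F₁ f ∘ (η α X ∘ β X))       ≈⟨ ∘-congˡ (assoc _ _ _) ⟨
      β Y ∘ ((G.F₁ f ∘ η α X) ∘ β X)       ≈⟨ ∘-congˡ (∘-congʳ (commute α f)) ⟨
      β Y ∘ ((η α Y ∘ F.F₁ f) ∘ β X)       ≈⟨ ∘-congˡ (assoc _ _ _) ⟩
      β Y ∘ (η α Y ∘ (F.F₁ f ∘ β X))       ≈⟨ assoc _ _ _ ⟨
      (β Y ∘ η α Y) ∘ (F.F₁ f ∘ β X)       ≈⟨ ∘-congʳ (βα≈id Y) ⟩
      id ∘ (F.F₁ f ∘ β X)                  ≈⟨ identityˡ _ ⟩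
      F.F₁ f ∘ β X                         ∎

-- The shape of an `m`-fold product. Parallel arrows are identified, so deciding `A ≡ B` is enough
-- to enumerate each hom-setoid.
Discrete : ℕ → Category 0ℓ 0ℓ 0ℓ
Discrete m = record
  { Obj = Fin m
  ; _⇒_ = _≡_
  ; _≈_ = λ _ _ → Unit
  ; id  = ≡.refl
  ; _∘_ = λ q p → ≡.trans p q
  ; equiv     = _
  ; assoc     = _
  ; identityˡ = _
  ; identityʳ = _
  ; ∘-resp-≈  = _
  }

Discrete-finite : ∀ m → IsFinite (Discrete m)
Discrete-finite m = (m , Identity.↔-id (Fin m)) , homs
  where
  homs : ∀ A B → ∃[ n ] Inverse (≡.setoid (Fin n)) (Category.homSetoid (Discrete m) A B)
  homs A B with A ≟ᶠ B
  ... | yes p = 1 , record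
    { to        = λ _ → p
    ; from      = λ _ → zero
    ; to-cong   = _
    ; from-cong = λ _ → ≡.refl
    ; inverse   = _ , λ { {zero} _ → ≡.refl }
    }
  ... | no ¬p = 0 , record
    { to        = λ ()
    ; from      = λ p → contradiction p ¬p
    ; to-cong   = λ { {()} }
    ; from-cong = λ {p} _ → contradiction p ¬p
    ; inverse   = (λ {p} _ → contradiction p ¬p) , λ { {()} }
    }

module _ (m : ℕ) where

  constant-𝕀 : Functor (Discrete m) (Presheaves □)
  constant-𝕀 = record
    { F₀ = λ _ → 𝕀
    ; F₁ = λ _ → Category.id (Presheaves □)
    ; identity     = λ _ _ → ≃-refl
    ; homomorphism = λ _ _ _ _ → ≃-refl
    ; F-resp-≈     = λ _ _ _ → ≃-refl
    }

  generators : Cone constant-𝕀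
  generators = record
    { apex    = よ m
    ; π       = λ i → element 𝕀 (var i)
    ; commute = λ { ≡.refl _ _ → ≃-refl }
    }

  generators-limit : IsLimit generators
  generators-limit K = record
    { η       = λ U → record
      { to   = λ z i → η (π i) U ⟨$⟩ z
      ; cong = λ p i → Func.cong (η (π i) U) p
      }
    ; commute = λ α z i → commute (π i) α z
    } , (λ _ _ _ → ≃-refl) , λ v p U z i → p i U z
    where
    open Cone K using (π)
    open NaturalTransformation

module Uniqueness {C : Category 0ℓ 0ℓ 0ℓ} {P : Presheaf C} (L : LatticeObject P)
                  (projective : ∀ U → Projective (LatticeObject.sections L U))
                  (g : GeometricMorphism (Presheaves C) (Presheaves □)) (c : Classifies g L) where
  open InverseImage L projective
  open LatticeObjectProperties L
  open Sections P
  open SectionProperties P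
  open NaturalTransformation using (η)
  open GeometricMorphism g
    renaming (inverseImage to g*; directImage to g₊; adjunction to g-adjunction; lex to g*-lex)
  open Functor g* using () renaming (F₀ to g*₀; F₁ to g*₁)
  open Classifies c using (φ; iso; preserves-meet; preserves-join; preserves-top; preserves-bot)
  open Iso iso using () renaming (from to φ⁻¹; isoˡ to φ⁻¹∘φ; isoʳ to φ∘φ⁻¹)
  open Transposition g-adjunction
  private
    module □ˆ = Category (Presheaves □)
    module Cˆ = Category (Presheaves C)
    module g* = Functor g*
    module 𝕀 = LatticeObject 𝕀-lattice
    module L = LatticeObject L
    module G (X : Presheaf □) where
      open Sections (g*₀ X) public
      open SectionProperties (g*₀ X) public

  g*₁-∘ : ∀ {X Y Z} {h : NaturalTransformation Y Z} {k : NaturalTransformation X Y}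
          {l : NaturalTransformation X Z} → h □ˆ.∘ k □ˆ.≈ l →
          ∀ {U} w → G._≈_ Z {U} (η (g*₁ h) U ⟨$⟩ (η (g*₁ k) U ⟨$⟩ w)) (η (g*₁ l) U ⟨$⟩ w)
  g*₁-∘ {Z = Z} p {U} w = G.trans Z (G.sym Z (g*.homomorphism _ _ U w)) (g*.F-resp-≈ p U w)

  -- A section of `g*₀ (よ m)` behaves as an `m`-tuple of sections of `P`: a polynomial is a map from
  -- `よ m` to `𝕀`, which `g*` and `φ` carry to a map into `P`.
  eval : ∀ {m U} → G.Γ (よ m) U → Poly m → Γ U
  eval {U = U} w t = η φ U ⟨$⟩ (η (g*₁ (element 𝕀 t)) U ⟨$⟩ w)

  -- `element 𝕀 r` factors as `op` after a pairing; `g*` keeps this factorization, and the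
  -- preservation hypothesis replaces `op` by `opᴸ`.
  eval-binary : (op : NaturalTransformation (𝕀 ×ᵖ 𝕀) 𝕀) (opᴸ : NaturalTransformation (P ×ᵖ P) P) →
                φ Cˆ.∘ g*₁ op Cˆ.≈ opᴸ Cˆ.∘ ⟨ φ Cˆ.∘ g*₁ projˡ , φ Cˆ.∘ g*₁ projʳ ⟩ →
                ∀ {m} (r s t : Poly m) → op □ˆ.∘ ⟨ element 𝕀 s , element 𝕀 t ⟩ □ˆ.≈ element 𝕀 r →
                ∀ {U} (w : G.Γ (よ m) U) {x y} → eval w s ≈ x → eval w t ≈ y →
                eval w r ≈ η opᴸ U ⟨$⟩ (x , y)
  eval-binary op opᴸ preserves r s t op⟨s,t⟩≈r {U} w s≈x t≈y = trans
    (Func.cong (η φ U) (G.sym 𝕀 (g*₁-∘ {h = op} {pair} op⟨s,t⟩≈r w)))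
    (trans (preserves U _) (Func.cong (η opᴸ U)
      ( trans (Func.cong (η φ U) (g*₁-∘ {h = projˡ {Q = 𝕀}} {pair} (λ _ _ → ≃-refl) w)) s≈x
      , trans (Func.cong (η φ U) (g*₁-∘ {h = projʳ {P = 𝕀}} {pair} (λ _ _ → ≃-refl) w)) t≈y)))
    where
    pair : NaturalTransformation _ (𝕀 ×ᵖ 𝕀)
    pair = ⟨ element 𝕀 s , element 𝕀 t ⟩

  eval-nullary : (op : NaturalTransformation 𝟙ᵖ 𝕀) (opᴸ : NaturalTransformation 𝟙ᵖ P) →
                 φ Cˆ.∘ g*₁ op Cˆ.≈ opᴸ Cˆ.∘ ! → ∀ {m} (r : Poly m) → op □ˆ.∘ ! □ˆ.≈ element 𝕀 r →
                 ∀ {U} (w : G.Γ (よ m) U) → eval w r ≈ η opᴸ U ⟨$⟩ tt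
  eval-nullary op opᴸ preserves r op≈r {U} w = trans
    (Func.cong (η φ U) (G.sym 𝕀 (g*₁-∘ {h = op} { ! } op≈r w))) (preserves U _)

  eval-⟦⟧ : ∀ {m U} (w : G.Γ (よ m) U) (t : Poly m) → eval w t ≈ ⟦ t ⟧ (λ i → eval w (var i))
  eval-⟦⟧ w (var i) = refl
  eval-⟦⟧ w (s ∨ t) = eval-binary 𝕀.join L.join preserves-join (s ∨ t) s t
                        (λ _ _ → ≃-refl) w (eval-⟦⟧ w s) (eval-⟦⟧ w t)
  eval-⟦⟧ w (s ∧ t) = eval-binary 𝕀.meet L.meet preserves-meet (s ∧ t) s t
                        (λ _ _ → ≃-refl) w (eval-⟦⟧ w s) (eval-⟦⟧ w t)
  eval-⟦⟧ w ⊤       = eval-nullary 𝕀.top L.top preserves-top ⊤ (λ _ _ → ≃-refl) w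
  eval-⟦⟧ w ⊥       = eval-nullary 𝕀.bot L.bot preserves-bot ⊥ (λ _ _ → ≃-refl) w

  ψ : ∀ m → NaturalTransformation (g*₀ (よ m)) (power m)
  ψ m = record
    { η = λ U → record
      { to   = λ w i → eval w (var i)
      ; cong = λ p i → Func.cong (η φ U) (Func.cong (η (g*₁ (element 𝕀 (var i))) U) p)
      }
    ; commute = λ f w i → NaturalTransformation.commute (φ Cˆ.∘ g*₁ (element 𝕀 (var i))) f w
    }

  ψ-natural : ∀ {k m} (α : Fin m → Poly k) → ψ m Cˆ.∘ g*₁ (element (よ m) α) Cˆ.≈ act α Cˆ.∘ ψ k
  ψ-natural {k} α U w i = trans
    (Func.cong (η φ U) (g*₁-∘ {h = element 𝕀 (var i)} {element (よ _) α} {element 𝕀 (α i)}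
                          (λ _ _ → ≃-refl) w))
    (eval-⟦⟧ w (α i))

  module _ (m : ℕ) where
    private
      L-cone : Cone (g* ∘F constant-𝕀 m)
      L-cone = mapCone g* (generators m)

      L-limit : IsLimit L-cone
      L-limit = g*-lex (Discrete m) (Discrete-finite m) (constant-𝕀 m)
                  (generators m) (generators-limit m)

      cone : Cone (g* ∘F constant-𝕀 m)
      cone = record
        { apex    = power m
        ; π       = λ i → φ⁻¹ Cˆ.∘ coordinate i
        ; commute = λ { {i} ≡.refl U d → g*.identity U _ }
        }
        where
        coordinate : Fin m → NaturalTransformation (power m) P
        coordinate i = record
          { η       = λ U → record { to = λ d → d i ; cong = λ p → p i }
          ; commute = λ f d → refl
          }

    χ : NaturalTransformation (power m) (g*₀ (よ m))
    χ = proj₁ (L-limit cone)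

    ψ∘χ : ψ m Cˆ.∘ χ Cˆ.≈ Cˆ.id
    ψ∘χ U d i = trans (Func.cong (η φ U) (proj₁ (proj₂ (L-limit cone)) i U d)) (φ∘φ⁻¹ U (d i))

    χ∘ψ : χ Cˆ.∘ ψ m Cˆ.≈ Cˆ.id
    χ∘ψ U w = PresheafLimit.π-injective L-cone L-limit _ w λ i → G.trans 𝕀
      (proj₁ (proj₂ (L-limit cone)) i U (η (ψ m) U ⟨$⟩ w))
      (φ⁻¹∘φ U (η (g*₁ (element 𝕀 (var i))) U ⟨$⟩ w))

  -- The counterpart of `realize` for the other morphism `g`.
  point : (X : Presheaf □) {m : ℕ} → Sections.Γ X m → NaturalTransformation (power m) (g*₀ X)
  point X {m} x = g*₁ (element X x) Cˆ.∘ χ m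

  -- `χ` comes from a universal property, so its naturality in `m` is obtained from that of its
  -- inverse `ψ`.
  point-∣ : (X : Presheaf □) {k m : ℕ} (x : Sections.Γ X m) (α : Fin m → Poly k) →
            point X (Sections._∣_ X x α) Cˆ.≈ point X x Cˆ.∘ act α
  point-∣ X {k} {m} x α U d = G.trans X
    (G.sym X (g*₁-∘ {h = element X x} {element (よ m) α} {element X (Sections._∣_ X x α)}
                (λ _ β → SectionProperties.∣-∘ X x α β) _))
    (Func.cong (η (g*₁ (element X x)) U) (begin
      αχd                                ≈⟨ χ∘ψ m U αχd ⟨
      η (χ m) U ⟨$⟩ (η (ψ m) U ⟨$⟩ αχd)  ≈⟨ Func.cong (η (χ m) U) ψαχd≋αd ⟩
      η (χ m) U ⟨$⟩ (α ◃ d)              ∎))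
    where
    open SetoidReasoning (Functor.F₀ (g*₀ (よ m)) U)
    αχd : G.Γ (よ m) U
    αχd = η (g*₁ (element (よ m) α)) U ⟨$⟩ (η (χ k) U ⟨$⟩ d)
    ψαχd≋αd : η (ψ m) U ⟨$⟩ αχd ≋ α ◃ d
    ψαχd≋αd i = trans (ψ-natural α U (η (χ k) U ⟨$⟩ d) i) (⟦⟧-congʳ (α i) (ψ∘χ k U d))

  -- The left adjoint `g*` keeps the family of all maps from representables to `X` jointly epic:
  -- after transposition, the value at `x` is read off at `var`, as in the Yoneda lemma.
  jointly-epic : ∀ {X Z} (a b : NaturalTransformation (g*₀ X) Z) →
                 (∀ {m} (x : Sections.Γ X m) →
                   a Cˆ.∘ g*₁ (element X x) Cˆ.≈ b Cˆ.∘ g*₁ (element X x)) →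
                 a Cˆ.≈ b
  jointly-epic {X} {Z} a b p = adjunct-injective λ m x → begin
    η (adjunct a) m ⟨$⟩ x                              ≈⟨ at-identity a x ⟩
    η (adjunct (a Cˆ.∘ g*₁ (element X x))) m ⟨$⟩ var    ≈⟨ adjunct-cong (p x) m var ⟩
    η (adjunct (b Cˆ.∘ g*₁ (element X x))) m ⟨$⟩ var    ≈⟨ at-identity b x ⟨
    η (adjunct b) m ⟨$⟩ x                              ∎
    where
    module _ {m : ℕ} where
      open SetoidReasoning (Functor.F₀ (Functor.F₀ g₊ Z) m) public
    module Z = SectionProperties (Functor.F₀ g₊ Z)
    open Sections (Functor.F₀ g₊ Z) using () renaming (_≈_ to _≈ᶻ_)

    at-identity : ∀ (c : NaturalTransformation (g*₀ X) Z) {m} (x : Sections.Γ X m) →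
                  η (adjunct c) m ⟨$⟩ x ≈ᶻ η (adjunct (c Cˆ.∘ g*₁ (element X x))) m ⟨$⟩ var
    at-identity c {m} x = Z.trans {m} {j = η (adjunct c) m ⟨$⟩ Sections._∣_ X x var}
      (Func.cong (η (adjunct c) m) (SectionProperties.sym X (SectionProperties.∣-id X x)))
      (adjunct-∘ c (element X x) m var)

  module _ (X : Presheaf □) where
    private module X where
      open Sections X public
      open SectionProperties X public

    θ : NaturalTransformation (Fixed.presheaf X) (g*₀ X)
    θ = record
      { η = λ U → record
        { to   = λ (x , _) → η (point X x) U ⟨$⟩ generator
        ; cong = λ p → g*.F-resp-≈ (λ _ α → X.∣-cong α p) U _
        }
      ; commute = λ {U} {V} f (x , _) → G.trans X (point-∣ X x ⌜ generator ∣* f ⌝ V generator)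
          (G.trans X (Func.cong (η (point X x) V) (⌜⌝-◃-generator (generator ∣* f)))
                     (NaturalTransformation.commute (point X x) f generator))
      }

    transposed : ∀ {m} → X.Γ m → NaturalTransformation (よ m) (Functor.F₀ g₊ (Fixed.presheaf X))
    transposed {m} x = adjunct (realize X x Cˆ.∘ ψ m)

    private
      module F = SectionProperties (Functor.F₀ g₊ (Fixed.presheaf X))
      open Sections (Functor.F₀ g₊ (Fixed.presheaf X)) using () renaming (_≈_ to _≈ᶠ_)

    transposed-∣ : ∀ {k m} (x : X.Γ m) (α : Fin m → Poly k) →
                   η (transposed (x X.∣ α)) k ⟨$⟩ var ≈ᶠ η (transposed x) k ⟨$⟩ α
    transposed-∣ {k} {m} x α = F.trans
      (adjunct-cong (λ U w → X.trans (X.sym (X.∣-∘ x α ⌜ η (ψ k) U ⟨$⟩ w ⌝))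
          (X.∣-congʳ x λ i → ≃-trans (⊙-⌜⌝ α (η (ψ k) U ⟨$⟩ w) i)
                                     (≃-sym (⌜⌝-cong (ψ-natural α U w) i)))) k var)
      (F.trans (F.sym (adjunct-∘ (realize X x Cˆ.∘ ψ m) (element (よ m) α) k var))
               (Func.cong (η (transposed x) k) λ i → ≡⇒≃ (substitute-var (α i))))

    -- `g*₀ X` has no elementwise description, so a map out of it is specified by its transpose. The
    -- value at `x` is the element corresponding under Yoneda to `transposed x`.
    κ♯ : NaturalTransformation X (Functor.F₀ g₊ (Fixed.presheaf X))
    κ♯ = record
      { η = λ m → record
        { to   = λ x → η (transposed x) m ⟨$⟩ var
        ; cong = λ p → adjunct-cong (λ U w → X.∣-cong _ p) m var
        }
      ; commute = λ {m} {k} α x → F.trans (transposed-∣ x α)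
          (NaturalTransformation.commute (transposed x) α var)
      }

    κ : NaturalTransformation (g*₀ X) (Fixed.presheaf X)
    κ = coadjunct κ♯

    -- By `jointly-epic` these equations determine `κ`; both inverse laws are computed from them.
    κ-element : ∀ {m} (x : X.Γ m) → κ Cˆ.∘ g*₁ (element X x) Cˆ.≈ realize X x Cˆ.∘ ψ m
    κ-element {m} x = begin
      κ Cˆ.∘ g*₁ (element X x)          ≈⟨ coadjunct-∘ κ♯ (element X x) ⟩
      coadjunct (κ♯ □ˆ.∘ element X x)   ≈⟨ coadjunct-cong {f = κ♯ □ˆ.∘ element X x} {transposed x}
                                             (λ k α → transposed-∣ x α) ⟩
      coadjunct (transposed x)          ≈⟨ coadjunct-adjunct (realize X x Cˆ.∘ ψ m) ⟩
      realize X x Cˆ.∘ ψ m              ∎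
      where open CategoryProperties.HomReasoning (Presheaves C)

    κ∘θ : κ Cˆ.∘ θ Cˆ.≈ Cˆ.id
    κ∘θ U (x , x-fixed) = X.trans (κ-element x U (η (χ (rank U)) U ⟨$⟩ generator))
      (X.trans (X.∣-congʳ x (⌜⌝-cong (ψ∘χ (rank U) U generator))) x-fixed)

    θ∘κ : θ Cˆ.∘ κ Cˆ.≈ Cˆ.id
    θ∘κ = jointly-epic (θ Cˆ.∘ κ) Cˆ.id λ {m} x U w → let d = η (ψ m) U ⟨$⟩ w in
      G.trans X (Func.cong (η θ U) {η (κ Cˆ.∘ g*₁ (element X x)) U ⟨$⟩ w}
                   {η (realize X x) U ⟨$⟩ d} (κ-element x U w))
      (G.trans X (point-∣ X x ⌜ d ⌝ U generator)
      (G.trans X (Func.cong (η (point X x) U) (⌜⌝-◃-generator d))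
                 (Func.cong (η (g*₁ (element X x)) U) (χ∘ψ m U w))))

  inverseImages-iso : Iso (Functors (Presheaves □) (Presheaves C)) inverseImage g*
  inverseImages-iso = invertNatural
    (record
      { η       = θ
      ; commute = λ {X} {Y} h U (x , _) → G.sym Y
          (g*₁-∘ {h = h} {element X x} {element Y (η h (rank U) ⟨$⟩ x)}
            (λ _ α → NaturalTransformation.commute h α x) _)
      })
    κ κ∘θ θ∘κ

  φ∘θ : φ Cˆ.∘ θ 𝕀 Cˆ.≈ Classifies.φ classifies
  φ∘θ U (t , _) = trans (eval-⟦⟧ (η (χ (rank U)) U ⟨$⟩ generator) t)
                        (⟦⟧-congʳ t (ψ∘χ (rank U) U generator))

module _ {C : Category 0ℓ 0ℓ 0ℓ} {P : Presheaf C} (L : LatticeObject P)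
         (projective : ∀ U → Projective (LatticeObject.sections L U)) where
  open InverseImage L projective

  classifies-unique : EssentiallyUnique classifies
  classifies-unique g c = inverseImages-iso , φ∘θ
    where open Uniqueness L projective g c

-- The generic linear order

module FiniteJoins (L : BoundedDistributiveLattice a ℓ) where
  open BoundedDistributiveLattice L using (Carrier)
  open LatticeOrder L
  private module L = BoundedDistributiveLattice L

  ⋁ : ∀ {k} → (Fin k → Carrier) → Carrier
  ⋁ = foldr L._∨_ L.⊥

  ⋁-upper : ∀ {k} (x : Fin k → Carrier) i → x i ≤ ⋁ x
  ⋁-upper x zero    = x≤x∨y _ _
  ⋁-upper x (suc i) = ≤-trans (⋁-upper (x ∘′ suc) i) (y≤x∨y _ _)

  ⋁-least : ∀ {k} (x : Fin k → Carrier) {y} → (∀ i → x i ≤ y) → ⋁ x ≤ y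
  ⋁-least {zero}  x p = ⊥-minimum _
  ⋁-least {suc k} x p = ∨-least (p zero) (⋁-least (x ∘′ suc) (λ i → p (suc i)))

module _ (L : BoundedDistributiveLattice a ℓ) {m : ℕ}
         (d : Fin m → BoundedDistributiveLattice.Carrier L) where
  open Evaluation L
  open FiniteJoins L

  ⟦⋁⟧ : ∀ {k} (t : Fin k → Poly m) →
        ⟦ FiniteJoins.⋁ (DL m) t ⟧ d ≡ ⋁ (λ i → ⟦ t i ⟧ d)
  ⟦⋁⟧ {zero}  t = ≡.refl
  ⟦⋁⟧ {suc k} t = ≡.cong (BoundedDistributiveLattice._∨_ L (⟦ t zero ⟧ d)) (⟦⋁⟧ (t ∘′ suc))

-- A map x : [n] → [1] is x(0) ∨ ⋁ᵢ (x(i+1) ∧ stepᵢ), where stepᵢ(k) = 1 iff i < k.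
module Generic (M : MinMaxLattice genericLinearOrder) where
  private
    module M = MinMaxLattice M
    module L = LatticeObject M.lattice
    module D = LinearOrder genericLinearOrder
  open Sections D.D
  open SectionProperties D.D
  open LatticeObjectProperties M.lattice
    renaming (_≤_ to _≤ᴹ_)
  open PosetHomomorphism using (mono)

  ≤Δ⇒≤ᴹ : ∀ {n} {x y : Γ n} → x ≤Δ y → x ≤ᴹ y
  ≤Δ⇒≤ᴹ = ≤⇒≤ᴹ genericLinearOrder M

  -- Here the order is total on the sections themselves: if `y ≤Δ x`, then the lattice inequality
  -- gives `x ≈ x ⋏ y ≈ y`.
  ≤ᴹ⇒≤Δ : ∀ {n} {x y : Γ n} → x ≤ᴹ y → x ≤Δ y
  ≤ᴹ⇒≤Δ {x = x} {y} x≈x⋏y with ≤Δ-total x y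
  ... | inj₁ x≤y = x≤y
  ... | inj₂ y≤x = λ i → ≤ᶠ-reflexive (≡.trans (x≈x⋏y i) (M.x≥y⇒x⋏y≈y y≤x i))

  module _ {n : ℕ} where
    open FiniteJoins (DL n) using (⋁; ⋁-least; ⋁-upper)

    scalar : Fin 2 → Poly n
    scalar zero    = ⊥
    scalar (suc _) = ⊤

    terms : Γ n → Fin n → Poly n
    terms x i = scalar (x · suc i) ∧ var i

    section : Γ n → Poly n
    section x = scalar (x · zero) ∨ ⋁ (terms x)

    scalar-mono : ∀ {p q} → p ≤ᶠ q → scalar p DLOrder.≤ scalar q
    scalar-mono {zero}  _ = DLOrder.⊥-minimum _
    scalar-mono {suc _} {suc _} _ = DLOrder.≤-refl

    -- A monotone map out of a chain preserves binary joins and meets, so `section-∨` and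
    -- `section-∧` reduce to this.
    section-mono : ∀ x y → x ≤Δ y → section x DLOrder.≤ section y
    section-mono x y x≤y = DLOrder.∨-monotonic (scalar-mono (x≤y zero))
      (⋁-least (terms x) λ i → DLOrder.≤-trans
        (DLOrder.∧-monotonic (scalar-mono (x≤y (suc i))) DLOrder.≤-refl)
        (⋁-upper (terms y) i))

    section-cong : ∀ x y → x ≈ y → section x ≃ section y
    section-cong x y p = DLOrder.≤-antisym (section-mono x y (λ i → ≤ᶠ-reflexive (p i)))
                                       (section-mono y x (λ i → ≤ᶠ-reflexive (≡.sym (p i))))

    section-∨ : ∀ x y → section (x L.⋎ y) ≃ section x ∨ section y
    section-∨ x y with ≤Δ-total x y
    ... | inj₁ x≤y = ≃-trans (section-cong (x L.⋎ y) y (M.x≤y⇒x⋎y≈y x≤y))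
                       (≃-sym (DLOrder.x≤y⇒x∨y≈y (section-mono x y x≤y)))
    ... | inj₂ y≤x = ≃-trans (section-cong (x L.⋎ y) x (M.x≥y⇒x⋎y≈x y≤x))
                       (≃-trans (≃-sym (DLOrder.x≤y⇒x∨y≈y (section-mono y x y≤x))) (∨-comm _ _))

    section-∧ : ∀ x y → section (x L.⋏ y) ≃ section x ∧ section y
    section-∧ x y with ≤Δ-total x y
    ... | inj₁ x≤y = ≃-trans (section-cong (x L.⋏ y) x (M.x≤y⇒x⋏y≈x x≤y))
                       (≃-trans (≃-sym (DLOrder.y≤x⇒x∧y≈y (section-mono x y x≤y))) (∧-comm _ _))
    ... | inj₂ y≤x = ≃-trans (section-cong (x L.⋏ y) y (M.x≥y⇒x⋏y≈y y≤x))
                       (≃-sym (DLOrder.y≤x⇒x∧y≈y (section-mono y x y≤x)))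

    section-⊤ : section L.1# ≃ ⊤
    section-⊤ = ≃-trans (section-cong L.1# D.1# M.1≈1)
      (DLOrder.≤-antisym (DLOrder.⊤-maximum _) (DLOrder.x≤x∨y ⊤ _))

    section-⊥ : section L.0# ≃ ⊥
    section-⊥ = ≃-trans (section-cong L.0# D.0# M.0≈0) (DLOrder.≤-antisym
      (DLOrder.∨-least DLOrder.≤-refl (⋁-least (terms D.0#) λ i → DLOrder.x∧y≤x ⊥ (var i)))
      (DLOrder.⊥-minimum _))

  step : ∀ {n} → Fin n → Fin (suc n) → Fin 2
  step i       zero    = zero
  step zero    (suc k) = suc zero
  step (suc i) (suc k) = step i k

  step-mono : ∀ {n} (i : Fin n) {k l} → k ≤ᶠ l → step i k ≤ᶠ step i l
  step-mono i       {zero}          _         = z≤n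
  step-mono zero    {suc k} {suc l} _         = s≤s z≤n
  step-mono (suc i) {suc k} {suc l} (s≤s k≤l) = step-mono i k≤l

  step-suc : ∀ {n} (i : Fin n) → step i (suc i) ≡ suc zero
  step-suc zero    = ≡.refl
  step-suc (suc i) = step-suc i

  step-jump : ∀ {n} (i : Fin n) k → step i k ≡ zero ⊎ suc i ≤ᶠ k
  step-jump i       zero    = inj₁ ≡.refl
  step-jump zero    (suc k) = inj₂ (s≤s z≤n)
  step-jump (suc i) (suc k) = Sum.map₂ s≤s (step-jump i k)

  generator : ∀ {n} → Fin n → Γ n
  generator i = mkPosetHomo _ _ (step i) (step-mono i)

  module _ {n : ℕ} (x : Γ n) where
    open FiniteJoins (L.sections n) using (⋁-least)

    ≤-after : ∀ {y k l} → y ≤ᶠ suc (zero {0}) → x · k ≡ suc zero → k ≤ᶠ l → y ≤ᶠ x · l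
    ≤-after y≤1 p k≤l = ≤ᶠ-trans y≤1 (≤ᶠ-trans (≤ᶠ-reflexive (≡.sym p)) (mono x k≤l))

    generator≤Δ : ∀ i → x · suc i ≡ suc zero → generator i ≤Δ x
    generator≤Δ i p k with step-jump i k
    ... | inj₁ q    = ≤ᶠ-trans (≤ᶠ-reflexive q) z≤n
    ... | inj₂ si≤k = ≤-after (D.maximum n (generator i) k) p si≤k

    -- The value is passed as `q` with an equation, so that `scalar q` can be split while the
    -- equation remains available for the monotonicity of `x`.
    ⟦scalar⟧-≤ : ∀ q → x · zero ≡ q → ⟦ scalar q ⟧ generator ≤ᴹ x
    ⟦scalar⟧-≤ zero       _ = ⊥-minimum x
    ⟦scalar⟧-≤ (suc zero) p = ≤Δ⇒≤ᴹ λ k → ≤-after (D.maximum n L.1# k) p z≤n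

    ⟦term⟧-≤ : ∀ i q → x · suc i ≡ q → ⟦ scalar q ∧ var i ⟧ generator ≤ᴹ x
    ⟦term⟧-≤ i zero       _ = ≤-trans (x∧y≤x _ _) (⊥-minimum x)
    ⟦term⟧-≤ i (suc zero) p = ≤-trans (x∧y≤y _ _) (≤Δ⇒≤ᴹ (generator≤Δ i p))

    ≤-⟦scalar⟧ : ∀ q k → q ≤ᶠ ⟦ scalar {n} q ⟧ generator · k
    ≤-⟦scalar⟧ zero       k = z≤n
    ≤-⟦scalar⟧ (suc zero) k = ≤ᶠ-reflexive (≡.sym (M.1≈1 k))

    ≤-⟦term⟧ : ∀ i q → q ≤ᶠ ⟦ scalar q ∧ var i ⟧ generator · suc i
    ≤-⟦term⟧ i zero       = z≤n
    ≤-⟦term⟧ i (suc zero) = ≤ᶠ-reflexive (≡.sym (≡.trans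
      (BoundedDistributiveLattice.∧-identityˡ (L.sections n) (generator i) (suc i)) (step-suc i)))

    ⟦section⟧-≤ : ⟦ section x ⟧ generator ≤ᴹ x
    ⟦section⟧-≤ = ∨-least (⟦scalar⟧-≤ (x · zero) ≡.refl)
      (≡.subst (_≤ᴹ x) (≡.sym (⟦⋁⟧ (L.sections n) generator (terms x)))
        (⋁-least _ λ i → ⟦term⟧-≤ i (x · suc i) ≡.refl))

    ⟦⟧-≤-⟦section⟧ : ∀ {t} → t DLOrder.≤ section x → ⟦ t ⟧ generator ≤Δ ⟦ section x ⟧ generator
    ⟦⟧-≤-⟦section⟧ p = ≤ᴹ⇒≤Δ (⟦⟧-congˡ p generator)

    -- One summand suffices at each point: the scalar at `zero`, and the `i`-th term at `suc i`, the
    -- first place where `step i` is 1.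
    ≤-⟦section⟧ : x ≤Δ ⟦ section x ⟧ generator
    ≤-⟦section⟧ zero    = ≤ᶠ-trans (≤-⟦scalar⟧ (x · zero) zero)
      (⟦⟧-≤-⟦section⟧ {scalar (x · zero)} (DLOrder.x≤x∨y _ _) zero)
    ≤-⟦section⟧ (suc i) = ≤ᶠ-trans (≤-⟦term⟧ i (x · suc i))
      (⟦⟧-≤-⟦section⟧ {terms x i}
        (DLOrder.≤-trans (FiniteJoins.⋁-upper (DL n) (terms x) i) (DLOrder.y≤x∨y _ _)) (suc i))

  projective : ∀ n → Projective (L.sections n)
  projective n = record
    { rank         = n
    ; generator    = generator
    ; section      = section
    ; section-cong = λ {x} {y} → section-cong x y
    ; section-∨    = section-∨
    ; section-∧    = section-∧
    ; section-⊤    = section-⊤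
    ; section-⊥    = section-⊥
    ; retract      = λ x → ≤-antisym (⟦section⟧-≤ x) (≤Δ⇒≤ᴹ (≤-⟦section⟧ x))
    }

proposition2 :
  (ℓ j : Level) →
  ((S : Site ℓ j) (D : LinearOrder S) → Σ[ M ∈ MinMaxLattice D ] IsFlat S (lattice M))
  ×
  ((M : MinMaxLattice genericLinearOrder) →
    Σ[ f ∈ GeometricMorphism (Presheaves Δ) (Presheaves □) ]
    Σ[ c ∈ Classifies f (lattice M) ]
      EssentiallyUnique c)
proposition2 ℓ j =
  (λ S D → minMaxLattice D , flat D (minMaxLattice D)) ,
  (λ M → let open InverseImage (lattice M) (Generic.projective M) in
    geometricMorphism , classifies , classifies-unique (lattice M) (Generic.projective M))
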